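{- For the quantile process $\mathrm{Quantile}(\delta)$ on $n$ bins with $\delta \in [1/3, 2/3]$ and any $m \geq 1$, \[ \Pr[\mathrm{Gap}(m) \leq 300 \log n] \geq 1 - O(n^{ -2}). \]
   Context: Balls are allocated sequentially into $n$ bins, starting from all loads $0$. Let $x_i^{(t)}$ be the load of bin $i$ after $t$ balls, and $\mathrm{Gap}(t) := \max_{i} x_i^{(t)} - t/n$. Let $\mathrm{Rank}^{(t)}$ order bins by non-increasing load (rank $1$ = most loaded; ties broken arbitrarily). In $\mathrm{Quantile}(\delta)$, with $\delta$ a fixed multiple of $1/n$ used at every step, two bins are sampled independently and uniformly at random (with replacement); if exactly one of them has rank $> \delta n$, the ball is placed into it, otherwise into one of the two chosen uniformly at random. As throughout the paper, $n$ is assumed sufficiently large. -}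

module Defs where

open import Data.Nat using (ℕ; zero; suc; _+_; _*_; _∸_; _^_; _≤_; _<_; _⊔_)
open import Data.Nat using (_!)
open import Relation.Binary.PropositionalEquality using (_≡_)
open import Data.Fin using (Fin; toℕ)
open import Data.List using (List; []; _∷_; foldr; allFin)
open import Data.Bool using (Bool; true; false; if_then_else_)
open import Data.Product using (_×_; _,_)
open import Relation.Nullary using (¬_)
open import Relation.Nullary.Decidable using (⌊_⌋)
open import Data.Nat using (_≤?_)

Loads : ℕ → Set
Loads n = Fin n → ℕ

-- One step's randomness: two bins (independent, uniform, with replacement)
-- and a fair coin used to pick one of them uniformly when needed.
Sample : ℕ → Set
Sample n = Fin n × Fin n × Bool

-- A ranking (0-based ranks: toℕ (r i) = Rank(i) - 1).
Rank : ℕ → Set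
Rank n = Fin n → Fin n

record IsRanking {n : ℕ} (x : Loads n) (r : Rank n) : Set where
  field
    injective : ∀ i j → r i ≡ r j → i ≡ j
    monotone  : ∀ i j → x j < x i → toℕ (r i) < toℕ (r j)

-- Tie-breaking rule: may depend on the whole history (most recent first).
TieRule : ℕ → Set
TieRule n = List (Sample n) → Rank n

-- Bin i has Rank > δn where δn = d (rank 1-based), i.e. 0-based rank ≥ d.
light : {n : ℕ} → ℕ → Rank n → Fin n → Bool
light d r i = ⌊ d ≤? toℕ (r i) ⌋

-- Quantile(δ) decision with δ n = d.
choose : {n : ℕ} → ℕ → Rank n → Sample n → Fin n
choose d r (i , j , b) with light d r i | light d r j
... | true  | false = i
... | false | true  = j
... | _     | _     = if b then i else j

addBall : {n : ℕ} → Loads n → Fin n → Loads n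
addBall {n} x k i with Data.Fin._≟_ i k
... | Relation.Nullary.yes _ = suc (x i)
... | Relation.Nullary.no  _ = x i

loads : {n : ℕ} → ℕ → TieRule n → List (Sample n) → Loads n
loads d rule []      = λ _ → 0
loads d rule (s ∷ h) = addBall (loads d rule h) (choose d (rule h) s)

maxLoad : {n : ℕ} → Loads n → ℕ
maxLoad {n} x = foldr (λ i acc → x i ⊔ acc) 0 (allFin n)

-- expNum a k = Σ_{j=0}^{k} a^j · k!/j!   (so expNum a k / k! is the k-th
-- partial sum of the series of e^a).
expNum : ℕ → ℕ → ℕ
expNum a zero    = 1
expNum a (suc k) = suc k * expNum a k + a ^ suc k

-- e^a ≤ N  (real exponential), via all partial sums of the exponential series.
ExpLe : ℕ → ℕ → Set
ExpLe a N = ∀ k → expNum a k ≤ N * (k !)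

-- Gap(m) ≤ 300 ln n, where Gap(m) = maxLoad - m/n, after history h of length m.
-- Equivalent to e^{n·maxLoad - m} ≤ n^{300 n} (trivial if n·maxLoad ≤ m).
GapSmall : (n : ℕ) → Loads n → ℕ → Set
GapSmall n x m = ExpLe (n * maxLoad x ∸ m) (n ^ (300 * n))

module Submission where

-- Let β = 1 + 1/(50n) and consider the exact rational potentials Φ = Σ β^(n xᵢ − t), Ψ = Σ β^(t − n xᵢ)
-- and Γ = Φ + Ψ. To first order a step changes Φ by a multiple of dΦ_L − (n − d)Φ_H and Ψ by the same
-- multiple of (n − d)Ψ_H − dΨ_L, where H and L are the heavy and the light bins. Let the loads of H and L
-- be separated by a level y above the average (below it, the argument applies with Φ and Ψ exchanged).
-- Then Ψ_H ≤ n, so Ψ decreases. As for Φ, the surplus of H is balanced by L: either at least d/2 light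
-- bins lie below the average, which makes Φ_L smaller than Φ_H allows, or some bin lies 2y below it, and then
-- Ψ ≥ z² dominates Φ_L ≤ nz, where z is the weight at level y. Hence E Γ' ≤ (1 − Ω(1/n)) Γ + O(n) and
-- E Γ = O(n²). A gap above 300 ln n forces Γ ≥ n⁴, so Markov's inequality gives the bound O(n⁻²).

open import Defs
open import Algebra.Bundles using (CommutativeRing)
open import Data.Bool using (Bool; true; false; not; _∧_)
open import Data.Empty using (⊥-elim)
open import Data.Fin as Fin using (Fin; toℕ)
open import Data.Fin.Properties using (any?)
import Data.Integer as ℤ
open import Data.List using (List; []; _∷_; _++_; foldr; map; length; allFin; cartesianProduct; concatMap)
open import Data.List.Membership.Propositional using (_∈_)
open import Data.List.Membership.Propositional.Properties
  using (∈-∃++; ∈-++⁺ˡ; ∈-++⁺ʳ; ∈-++⁻; ∈-allFin; ∈-map⁺; ∈-cartesianProduct⁺; ∈-concatMap⁺)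
open import Data.List.Properties using (length-tabulate; map-tabulate)
open import Data.List.Relation.Unary.All as All using (All; []; _∷_)
open import Data.List.Relation.Unary.AllPairs using ([]; _∷_)
open import Data.List.Relation.Unary.Any as Any using (here; there)
open import Data.List.Relation.Unary.Unique.Propositional using (Unique)
open import Data.List.Relation.Unary.Unique.Propositional.Properties using (allFin⁺; map⁺)
open import Data.Nat as ℕ using (ℕ; zero; suc; z≤n; s≤s; _!)
import Data.Nat.Properties as ℕ
open import Data.Product using (Σ; ∃; _×_; _,_; proj₁; proj₂)
open import Data.Rational hiding (floor; truncate)
open import Data.Rational.Properties
open import Data.Rational.Solver using (module +-*-Solver)
open import Data.Sum using (_⊎_; inj₁; inj₂)
open import Function using (_∘_; id)
open import Relation.Binary.PropositionalEquality
open import Relation.Nullary using (¬_; yes; no)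
open import Relation.Nullary.Decidable using (True; toWitness; ⌊_⌋; isYes≗does)
open import Algebra.Properties.Semiring.Exp (CommutativeRing.semiring +-*-commutativeRing)
  using (_^_; ^-homo-*; ^-assocʳ)
open +-*-Solver using (solve; con; _:+_; _:*_; _:-_; _:=_)

private variable
  A B : Set
  p q r : ℚ

-- Ordered arithmetic in ℚ and the embedding of ℕ.

infixl 6 _⊕_
infixl 7 _⊗_

_⊕_ : 0ℚ ≤ p → 0ℚ ≤ q → 0ℚ ≤ p + q
_⊕_ = +-mono-≤

_⊗_ : 0ℚ ≤ p → 0ℚ ≤ q → 0ℚ ≤ p * q
_⊗_ {p} {q} 0≤p 0≤q =
  nonNegative⁻¹ (p * q) {{nonNeg*nonNeg⇒nonNeg p {{nonNegative 0≤p}} q {{nonNegative 0≤q}}}}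

slack : p ≤ q → 0ℚ ≤ q - p
slack {p} {q} p≤q = subst (_≤ q - p) (+-inverseʳ p) (+-monoˡ-≤ (- p) p≤q)

-- Linear arithmetic: q exceeds p by a combination r of nonnegative slacks; the ring solver checks q ≡ p + r.
≤-by : 0ℚ ≤ r → q ≡ p + r → p ≤ q
≤-by {r} {q} {p} 0≤r eq = subst₂ _≤_ (+-identityʳ p) (sym eq) (+-monoʳ-≤ p 0≤r)

0≤const : ∀ c → {True (0ℚ ≤? c)} → 0ℚ ≤ c
0≤const c {t} = toWitness t

0≤x² : ∀ x → 0ℚ ≤ x * x
0≤x² x with ≤-total 0ℚ x
... | inj₁ 0≤x = 0≤x ⊗ 0≤x
... | inj₂ x≤0 = subst (0ℚ ≤_) (solve 1 (λ x → (con 0ℚ :- x) :* (con 0ℚ :- x) := x :* x) refl x) (slack x≤0 ⊗ slack x≤0)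

*-mono-≤ : ∀ {p q r s} → 0ℚ ≤ p → 0ℚ ≤ s → p ≤ q → r ≤ s → p * r ≤ q * s
*-mono-≤ {p} {q} {r} {s} 0≤p 0≤s p≤q r≤s = ≤-by (slack p≤q ⊗ 0≤s ⊕ 0≤p ⊗ slack r≤s)
  (solve 4 (λ p q r s → q :* s := p :* r :+ ((q :- p) :* s :+ p :* (s :- r))) refl p q r s)

*-monoˡ : ∀ {p q r} → 0ℚ ≤ r → p ≤ q → r * p ≤ r * q
*-monoˡ {r = r} 0≤r = *-monoˡ-≤-nonNeg r {{nonNegative 0≤r}}

-- The recursion makes `ι (suc k)` unfold to `1ℚ + ι k`, so inductive steps become ring identities
-- for the solver.
ι : ℕ → ℚ
ι zero    = 0ℚ
ι (suc k) = 1ℚ + ι k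

0≤ι : ∀ k → 0ℚ ≤ ι k
0≤ι zero    = ≤-refl
0≤ι (suc k) = 0≤const 1ℚ ⊕ 0≤ι k

ι-+ : ∀ k l → ι (k ℕ.+ l) ≡ ι k + ι l
ι-+ zero    l = sym (+-identityˡ (ι l))
ι-+ (suc k) l = trans (cong (1ℚ +_) (ι-+ k l)) (sym (+-assoc 1ℚ (ι k) (ι l)))

ι-* : ∀ k l → ι (k ℕ.* l) ≡ ι k * ι l
ι-* zero    l = sym (*-zeroˡ (ι l))
ι-* (suc k) l = trans (ι-+ l (k ℕ.* l)) (trans (cong (_+_ (ι l)) (ι-* k l))
  (solve 2 (λ k l → l :+ k :* l := (con 1ℚ :+ k) :* l) refl (ι k) (ι l)))

ι-^ : ∀ k m → ι (k ℕ.^ m) ≡ ι k ^ m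
ι-^ k zero    = refl
ι-^ k (suc m) = trans (ι-* k (k ℕ.^ m)) (cong (ι k *_) (ι-^ k m))

ι-mono : ∀ {k l} → k ℕ.≤ l → ι k ≤ ι l
ι-mono {l = l} z≤n = 0≤ι l
ι-mono (s≤s k≤l) = +-monoʳ-≤ 1ℚ (ι-mono k≤l)

ι-cancel-≤ : ∀ {k l} → ι k ≤ ι l → k ℕ.≤ l
ι-cancel-≤ {k} {l} ιk≤ιl with k ℕ.≤? l
... | yes k≤l = k≤l
... | no  k≰l = ⊥-elim (<-irrefl refl (<-≤-trans (subst (_< 1ℚ + ι l) (+-identityˡ (ι l))
                  (+-monoˡ-< (ι l) (positive⁻¹ 1ℚ)))
                  (≤-trans (ι-mono {suc l} {k} (ℕ.≰⇒> k≰l)) ιk≤ιl)))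

𝟙 : Bool → ℚ
𝟙 true  = 1ℚ
𝟙 false = 0ℚ

0≤𝟙 : ∀ b → 0ℚ ≤ 𝟙 b
0≤𝟙 true  = 0≤const 1ℚ
0≤𝟙 false = ≤-refl

-- Finite sums

∑ : List A → (A → ℚ) → ℚ
∑ []       f = 0ℚ
∑ (x ∷ xs) f = f x + ∑ xs f

∑-cong : ∀ (xs : List A) {f g : A → ℚ} → (∀ x → f x ≡ g x) → ∑ xs f ≡ ∑ xs g
∑-cong []       eq = refl
∑-cong (x ∷ xs) eq = cong₂ _+_ (eq x) (∑-cong xs eq)

∑-mono : ∀ (xs : List A) {f g : A → ℚ} → (∀ x → f x ≤ g x) → ∑ xs f ≤ ∑ xs g
∑-mono []       le = ≤-refl
∑-mono (x ∷ xs) le = +-mono-≤ (le x) (∑-mono xs le)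

∑-nonneg : ∀ (xs : List A) {f : A → ℚ} → (∀ x → 0ℚ ≤ f x) → 0ℚ ≤ ∑ xs f
∑-nonneg []       0≤f = ≤-refl
∑-nonneg (x ∷ xs) 0≤f = 0≤f x ⊕ ∑-nonneg xs 0≤f

∑-+ : ∀ (xs : List A) (f g : A → ℚ) → ∑ xs (λ x → f x + g x) ≡ ∑ xs f + ∑ xs g
∑-+ []       f g = refl
∑-+ (x ∷ xs) f g = trans (cong (_+_ (f x + g x)) (∑-+ xs f g))
  (solve 4 (λ a b c d → a :+ b :+ (c :+ d) := a :+ c :+ (b :+ d)) refl (f x) (g x) (∑ xs f) (∑ xs g))

∑-* : ∀ (xs : List A) c (f : A → ℚ) → ∑ xs (λ x → c * f x) ≡ c * ∑ xs f
∑-* []       c f = sym (*-zeroʳ c)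
∑-* (x ∷ xs) c f = trans (cong (_+_ (c * f x)) (∑-* xs c f)) (sym (*-distribˡ-+ c (f x) (∑ xs f)))

∑-const : ∀ (xs : List A) c → ∑ xs (λ _ → c) ≡ c * ι (length xs)
∑-const []       c = sym (*-zeroʳ c)
∑-const (x ∷ xs) c = trans (cong (c +_) (∑-const xs c))
  (solve 2 (λ c n → c :+ c :* n := c :* (con 1ℚ :+ n)) refl c (ι (length xs)))

∑-++ : ∀ (xs ys : List A) (f : A → ℚ) → ∑ (xs ++ ys) f ≡ ∑ xs f + ∑ ys f
∑-++ []       ys f = sym (+-identityˡ _)
∑-++ (x ∷ xs) ys f = trans (cong (f x +_) (∑-++ xs ys f)) (sym (+-assoc (f x) _ _))

∑-map : ∀ (g : A → B) (xs : List A) (f : B → ℚ) → ∑ (map g xs) f ≡ ∑ xs (λ x → f (g x))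
∑-map g []       f = refl
∑-map g (x ∷ xs) f = cong (_+_ (f (g x))) (∑-map g xs f)

∑-concatMap : ∀ (g : A → List B) (xs : List A) (f : B → ℚ) → ∑ (concatMap g xs) f ≡ ∑ xs (λ x → ∑ (g x) f)
∑-concatMap g []       f = refl
∑-concatMap g (x ∷ xs) f = trans (∑-++ (g x) (concatMap g xs) f) (cong (_+_ (∑ (g x) f)) (∑-concatMap g xs f))

∑-cartesianProduct : ∀ (xs : List A) (ys : List B) (f : A × B → ℚ) →
  ∑ (cartesianProduct xs ys) f ≡ ∑ xs (λ x → ∑ ys (λ y → f (x , y)))
∑-cartesianProduct []       ys f = refl
∑-cartesianProduct (x ∷ xs) ys f = trans (∑-++ (map (x ,_) ys) (cartesianProduct xs ys) f)
  (cong₂ _+_ (∑-map (x ,_) ys f) (∑-cartesianProduct xs ys f))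

∑-swap : ∀ (xs : List A) (ys : List B) (f : A → B → ℚ) →
  ∑ xs (λ x → ∑ ys (f x)) ≡ ∑ ys (λ y → ∑ xs (λ x → f x y))
∑-swap []       ys f = sym (trans (∑-const ys 0ℚ) (*-zeroˡ (ι (length ys))))
∑-swap (x ∷ xs) ys f = trans (cong (_+_ (∑ ys (f x))) (∑-swap xs ys f))
  (sym (∑-+ ys (f x) (λ y → ∑ xs (λ x → f x y))))

∑-∈ : ∀ {xs : List A} {x} {f : A → ℚ} → (∀ x → 0ℚ ≤ f x) → x ∈ xs → f x ≤ ∑ xs f
∑-∈ {xs = y ∷ xs} {f = f} 0≤f (here refl)  = ≤-by (∑-nonneg xs 0≤f) refl
∑-∈ {xs = y ∷ xs} {f = f} 0≤f (there x∈xs) = ≤-trans (∑-∈ 0≤f x∈xs)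
  (≤-by (0≤f y) (+-comm (f y) (∑ xs f)))

-- Because `xs` has no repetitions, each of its elements can be cancelled against one occurrence in
-- `ys`. This serves twice: for images under an injective ranking, and for bad histories among all
-- histories.
∑-⊆ : ∀ {xs ys : List A} {f : A → ℚ} → (∀ x → 0ℚ ≤ f x) → Unique xs →
  (∀ {x} → x ∈ xs → x ∈ ys) → ∑ xs f ≤ ∑ ys f
∑-⊆ {xs = []} {ys = ys} 0≤f u sub = ∑-nonneg ys 0≤f
∑-⊆ {xs = x ∷ xs} {f = f} 0≤f (x∉xs ∷ u) sub with ∈-∃++ (sub (here refl))
... | as , bs , refl = subst (f x + ∑ xs f ≤_) (sym eq) (+-monoʳ-≤ (f x) (∑-⊆ 0≤f u sub′))
  where
  eq : ∑ (as ++ x ∷ bs) f ≡ f x + ∑ (as ++ bs) f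
  eq = trans (∑-++ as (x ∷ bs) f) (trans
    (solve 3 (λ a x b → a :+ (x :+ b) := x :+ (a :+ b)) refl (∑ as f) (f x) (∑ bs f))
    (cong (f x +_) (sym (∑-++ as bs f))))
  sub′ : ∀ {y} → y ∈ xs → y ∈ as ++ bs
  sub′ y∈xs with ∈-++⁻ as (sub (there y∈xs))
  ... | inj₁ y∈as         = ∈-++⁺ˡ y∈as
  ... | inj₂ (here refl)  = ⊥-elim (All.lookup x∉xs y∈xs refl)
  ... | inj₂ (there y∈bs) = ∈-++⁺ʳ as y∈bs

∑-update : ∀ {xs : List A} {k} {f g : A → ℚ} → Unique xs → k ∈ xs → (∀ {i} → i ≢ k → f i ≡ g i) →
  ∑ xs f ≡ ∑ xs g + (f k - g k)
∑-update {k = k} {f} {g} (x∉xs ∷ u) (here {xs = xs} refl) eq = trans (cong (_+_ (f k)) (∑-off xs x∉xs))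
  (solve 3 (λ a b c → a :+ c := b :+ c :+ (a :- b)) refl (f k) (g k) (∑ xs g))
  where
  ∑-off : ∀ ys → All (_ ≢_) ys → ∑ ys f ≡ ∑ ys g
  ∑-off []       []           = refl
  ∑-off (y ∷ ys) (y≢ ∷ rest) = cong₂ _+_ (eq (y≢ ∘ sym)) (∑-off ys rest)
∑-update {k = k} {f} {g} (x∉xs ∷ u) (there {x = x} {xs = xs} k∈xs) eq =
  trans (cong₂ _+_ (eq (All.lookup x∉xs k∈xs)) (∑-update u k∈xs eq))
    (sym (+-assoc (g x) (∑ xs g) (f k - g k)))

-- Monotonicity of powers.

1≤pow : ∀ {x} k → 1ℚ ≤ x → 1ℚ ≤ x ^ k
1≤pow         zero    1≤x = ≤-refl
1≤pow {x} (suc k) 1≤x = ≤-trans (≤-reflexive (sym (*-identityˡ 1ℚ)))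
  (*-mono-≤ (0≤const 1ℚ) (≤-trans (0≤const 1ℚ) (1≤pow k 1≤x)) 1≤x (1≤pow k 1≤x))

0≤pow : ∀ {x} k → 0ℚ ≤ x → 0ℚ ≤ x ^ k
0≤pow zero    0≤x = 0≤const 1ℚ
0≤pow (suc k) 0≤x = 0≤x ⊗ 0≤pow k 0≤x

pow-mono : ∀ {x k l} → 1ℚ ≤ x → k ℕ.≤ l → x ^ k ≤ x ^ l
pow-mono {l = l} 1≤x z≤n       = 1≤pow l 1≤x
pow-mono         1≤x (s≤s k≤l) = *-monoˡ (≤-trans (0≤const 1ℚ) 1≤x) (pow-mono 1≤x k≤l)

-- Drift inequalities in terms of weight totals.

-- 1/18 is the least value of s² / (2N²) for N ≤ 3s, and ε = 1/576 leaves room for the second-order terms;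
-- 145 is 1 + 1/(4ε), from N z ≤ ε z² + N²/(4ε).
drift : ℚ → ℚ → ℚ → ℚ
drift N W V = (ℤ.+ 1 / 576) * N * V + (ℤ.+ 145 / 1) * (N * N * N) - (ℤ.+ 1 / 18) * N * W

module _ {N s : ℚ} (N≤3s : N ≤ (ℤ.+ 3 / 1) * s) (3s≤2N : (ℤ.+ 3 / 1) * s ≤ (ℤ.+ 2 / 1) * N) (1≤N : 1ℚ ≤ N) where

  private
    0≤N : 0ℚ ≤ N
    0≤N = ≤-trans (0≤const 1ℚ) 1≤N

    0≤s : 0ℚ ≤ s
    0≤s = ≤-by (0≤const (ℤ.+ 1 / 3) ⊗ (0≤N ⊕ slack N≤3s))
      (solve 2 (λ N s → s := con 0ℚ :+ con (ℤ.+ 1 / 3) :* (N :+ (con (ℤ.+ 3 / 1) :* s :- N))) refl N s)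

    0≤N-s : 0ℚ ≤ N - s
    0≤N-s = ≤-by (0≤const (ℤ.+ 1 / 3) ⊗ (0≤N ⊕ slack 3s≤2N))
      (solve 2 (λ N s → N :- s := con 0ℚ :+ con (ℤ.+ 1 / 3) :* (N :+ (con (ℤ.+ 2 / 1) :* N :- con (ℤ.+ 3 / 1) :* s))) refl N s)

  -- W₁ and W₀ are the weights on the two sides of the level; the third bound on W₀ is the loss caused by s/2 low bins.
  drift-balanced : ∀ {z W₁ W₀ V} → 0ℚ ≤ z → 0ℚ ≤ V → s * z ≤ W₁ → W₀ ≤ (N - s) * z →
    W₀ ≤ (N - s - ½ * s) * z + N → s * (W₁ + W₀) - N * W₁ ≤ drift N (W₁ + W₀) V
  drift-balanced {z} {W₁} {W₀} {V} 0≤z 0≤V sz≤W₁ W₀≤tz W₀≤ =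
    ≤-by (0≤const (ℤ.+ 1 / 576) ⊗ 0≤N ⊗ 0≤V
          ⊕ 0≤N ⊗ 0≤N-s
          -- This term is (9s² - N²) z / 18: the loss s² z / 2 due to the low bins pays for the
          -- decay N² z / 18 of a total weight N z.
          ⊕ 0≤const (ℤ.+ 1 / 18) ⊗ 0≤z ⊗ (slack N≤3s ⊗ (0≤N ⊕ 0≤const (ℤ.+ 3 / 1) ⊗ 0≤s))
          ⊕ 0≤s ⊗ slack W₀≤
          -- Any excess of W₁ over s z lowers the left side at rate N - s ≥ N/3 and the right side
          -- only at rate N/18; 5/18 = 1/3 - 1/18.
          ⊕ (0≤const (ℤ.+ 1 / 3) ⊗ slack 3s≤2N ⊕ 0≤const (ℤ.+ 5 / 18) ⊗ 0≤N) ⊗ slack sz≤W₁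
          ⊕ 0≤const (ℤ.+ 1 / 18) ⊗ 0≤N ⊗ slack W₀≤tz
          ⊕ 0≤const (ℤ.+ 145 / 1) ⊗ 0≤N ⊗ 0≤N ⊗ slack 1≤N
          ⊕ 0≤const (ℤ.+ 144 / 1) ⊗ 0≤N ⊗ 0≤N)
      (solve 6 (λ N s z W₁ W₀ V →
        con (ℤ.+ 1 / 576) :* N :* V :+ con (ℤ.+ 145 / 1) :* (N :* N :* N) :- con (ℤ.+ 1 / 18) :* N :* (W₁ :+ W₀)
        := s :* (W₁ :+ W₀) :- N :* W₁
        :+ (con (ℤ.+ 1 / 576) :* N :* V
            :+ N :* (N :- s)
            :+ con (ℤ.+ 1 / 18) :* z :* ((con (ℤ.+ 3 / 1) :* s :- N) :* (N :+ con (ℤ.+ 3 / 1) :* s))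
            :+ s :* ((N :- s :- con ½ :* s) :* z :+ N :- W₀)
            :+ (con (ℤ.+ 1 / 3) :* (con (ℤ.+ 2 / 1) :* N :- con (ℤ.+ 3 / 1) :* s) :+ con (ℤ.+ 5 / 18) :* N) :* (W₁ :- s :* z)
            :+ con (ℤ.+ 1 / 18) :* N :* ((N :- s) :* z :- W₀)
            :+ con (ℤ.+ 145 / 1) :* N :* N :* (N :- con 1ℚ)
            :+ con (ℤ.+ 144 / 1) :* N :* N)) refl N s z W₁ W₀ V)

  -- The left side is N W₀ - (N - s) W with W = W₁ + W₀. The second term decays at rate at least
  -- N/3, more than enough, and the first is charged to the opposite potential V.
  drift-spread : ∀ {z W₁ W₀ V} → 0ℚ ≤ W₁ + W₀ → W₀ ≤ N * z →
    N * z ≤ (ℤ.+ 1 / 576) * V + (ℤ.+ 144 / 1) * (N * N) →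
    s * (W₁ + W₀) - N * W₁ ≤ drift N (W₁ + W₀) V
  drift-spread {z} {W₁} {W₀} {V} 0≤W W₀≤ Nz≤ =
    ≤-by ((0≤const (ℤ.+ 1 / 3) ⊗ slack 3s≤2N ⊕ 0≤const (ℤ.+ 5 / 18) ⊗ 0≤N) ⊗ 0≤W
          ⊕ 0≤N ⊗ slack W₀≤ ⊕ 0≤N ⊗ slack Nz≤ ⊕ 0≤N ⊗ 0≤N ⊗ 0≤N)
      (solve 6 (λ N s z W₁ W₀ V →
        con (ℤ.+ 1 / 576) :* N :* V :+ con (ℤ.+ 145 / 1) :* (N :* N :* N) :- con (ℤ.+ 1 / 18) :* N :* (W₁ :+ W₀)
        := s :* (W₁ :+ W₀) :- N :* W₁
        :+ ((con (ℤ.+ 1 / 3) :* (con (ℤ.+ 2 / 1) :* N :- con (ℤ.+ 3 / 1) :* s) :+ con (ℤ.+ 5 / 18) :* N) :* (W₁ :+ W₀)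
            :+ N :* (N :* z :- W₀)
            :+ N :* (con (ℤ.+ 1 / 576) :* V :+ con (ℤ.+ 144 / 1) :* (N :* N) :- N :* z)
            :+ N :* N :* N)) refl N s z W₁ W₀ V)

  -- The gain N V₁ is at most N², while s ≥ N/3 turns - s V into decay.
  drift-opposite : ∀ {W V₁ V} → 0ℚ ≤ W → 0ℚ ≤ V → V₁ ≤ N → N * V₁ - s * V ≤ drift N V W
  drift-opposite {W} {V₁} {V} 0≤W 0≤V V₁≤N =
    ≤-by (0≤const (ℤ.+ 1 / 576) ⊗ 0≤N ⊗ 0≤W
          ⊕ (0≤const (ℤ.+ 1 / 3) ⊗ slack N≤3s ⊕ 0≤const (ℤ.+ 5 / 18) ⊗ 0≤N) ⊗ 0≤V
          ⊕ 0≤N ⊗ slack V₁≤N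
          ⊕ 0≤const (ℤ.+ 145 / 1) ⊗ 0≤N ⊗ 0≤N ⊗ slack 1≤N
          ⊕ 0≤const (ℤ.+ 144 / 1) ⊗ 0≤N ⊗ 0≤N)
      (solve 5 (λ N s W V₁ V →
        con (ℤ.+ 1 / 576) :* N :* W :+ con (ℤ.+ 145 / 1) :* (N :* N :* N) :- con (ℤ.+ 1 / 18) :* N :* V
        := N :* V₁ :- s :* V
        :+ (con (ℤ.+ 1 / 576) :* N :* W
            :+ (con (ℤ.+ 1 / 3) :* (con (ℤ.+ 3 / 1) :* s :- N) :+ con (ℤ.+ 5 / 18) :* N) :* V
            :+ N :* (N :- V₁)
            :+ con (ℤ.+ 145 / 1) :* N :* N :* (N :- con 1ℚ)
            :+ con (ℤ.+ 144 / 1) :* N :* N)) refl N s W V₁ V)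

-- Exponential weights and the drift across a level.

module Weight {β γ : ℚ} (1≤β : 1ℚ ≤ β) (0≤γ : 0ℚ ≤ γ) (βγ≡1 : β * γ ≡ 1ℚ) where

  -- β ^ (a − b), with natural exponents only
  w : ℕ → ℕ → ℚ
  w a b = β ^ a * γ ^ b

  private
    0≤β : 0ℚ ≤ β
    0≤β = ≤-trans (0≤const 1ℚ) 1≤β

  0≤w : ∀ a b → 0ℚ ≤ w a b
  0≤w a b = 0≤pow a 0≤β ⊗ 0≤pow b 0≤γ

  w-* : ∀ a b c e → w (a ℕ.+ c) (b ℕ.+ e) ≡ w a b * w c e
  w-* a b c e = trans (cong₂ _*_ (^-homo-* β a c) (^-homo-* γ b e))
    (solve 4 (λ x y z u → x :* y :* (z :* u) := x :* z :* (y :* u)) refl (β ^ a) (β ^ c) (γ ^ b) (γ ^ e))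

  w-diag : ∀ c → w c c ≡ 1ℚ
  w-diag zero    = refl
  w-diag (suc c) = trans (w-* 1 1 c c) (cong₂ _*_
    (trans (solve 2 (λ β γ → β :* con 1ℚ :* (γ :* con 1ℚ) := β :* γ) refl β γ) βγ≡1) (w-diag c))

  w-shift : ∀ a b c → w (a ℕ.+ c) (b ℕ.+ c) ≡ w a b
  w-shift a b c = trans (w-* a b c c) (trans (cong (w a b *_) (w-diag c)) (*-identityʳ (w a b)))

  -- Over the common factor `γ ^ (b + b′)` only a comparison of powers of β is left.
  w-mono : ∀ {a b a′ b′} → a ℕ.+ b′ ℕ.≤ a′ ℕ.+ b → w a b ≤ w a′ b′
  w-mono {a} {b} {a′} {b′} le = subst₂ _≤_ (w-shift a b b′)
    (trans (cong (w (a′ ℕ.+ b)) (ℕ.+-comm b b′)) (w-shift a′ b′ b))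
    (≤-trans (≤-reflexive (*-comm (β ^ (a ℕ.+ b′)) _)) (≤-trans
      (*-monoˡ (0≤pow (b ℕ.+ b′) 0≤γ) (pow-mono 1≤β le))
      (≤-reflexive (*-comm _ (β ^ (a′ ℕ.+ b))))))

  1≤w : ∀ {a b} → b ℕ.≤ a → 1ℚ ≤ w a b
  1≤w {a} {b} b≤a = ≤-trans (≤-reflexive (sym (w-diag 0)))
    (w-mono {0} {0} {a} {b} (ℕ.≤-trans b≤a (ℕ.≤-reflexive (sym (ℕ.+-identityʳ a)))))

  w≤1 : ∀ {a b} → a ℕ.≤ b → w a b ≤ 1ℚ
  w≤1 {a} {b} a≤b = ≤-trans (w-mono {a} {b} {0} {0} (ℕ.≤-trans (ℕ.≤-reflexive (ℕ.+-identityʳ a)) a≤b))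
    (≤-reflexive (w-diag 0))

  -- Bin i lies a i − b i above the average, and σ marks the bins on the upper side of the level Y.
  module Split {n : ℕ} (σ : Fin n → Bool) (a b : Fin n → ℕ) (Y : ℕ)
    (above : ∀ i → σ i ≡ true → Y ℕ.+ b i ℕ.≤ a i)
    (below : ∀ i → σ i ≡ false → a i ℕ.≤ Y ℕ.+ b i)
    (balanced : ∑ (allFin n) (λ i → ι (a i)) ≡ ∑ (allFin n) (λ i → ι (b i)))
    (N s : ℚ) (N≡ : N ≡ ∑ (allFin n) (λ _ → 1ℚ)) (s≡ : s ≡ ∑ (allFin n) (λ i → 𝟙 (σ i)))
    (N≤3s : N ≤ (ℤ.+ 3 / 1) * s) (3s≤2N : (ℤ.+ 3 / 1) * s ≤ (ℤ.+ 2 / 1) * N) (1≤N : 1ℚ ≤ N) where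

    private
      bins = allFin n
      z = w Y 0

    W V W₁ W₀ V₁ : ℚ
    W  = ∑ bins (λ i → w (a i) (b i))
    V  = ∑ bins (λ i → w (b i) (a i))
    W₁ = ∑ bins (λ i → 𝟙 (σ i) * w (a i) (b i))
    W₀ = ∑ bins (λ i → 𝟙 (not (σ i)) * w (a i) (b i))
    V₁ = ∑ bins (λ i → 𝟙 (σ i) * w (b i) (a i))

    W≡ : W ≡ W₁ + W₀
    W≡ = trans (∑-cong bins (λ i → split (σ i) (w (a i) (b i)))) (∑-+ bins _ _)
      where
      split : ∀ c x → x ≡ 𝟙 c * x + 𝟙 (not c) * x
      split true  x = solve 1 (λ x → x := con 1ℚ :* x :+ con 0ℚ :* x) refl x
      split false x = solve 1 (λ x → x := con 0ℚ :* x :+ con 1ℚ :* x) refl x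

    0≤W : 0ℚ ≤ W
    0≤W = ∑-nonneg bins (λ i → 0≤w (a i) (b i))

    0≤V : 0ℚ ≤ V
    0≤V = ∑-nonneg bins (λ i → 0≤w (b i) (a i))

    private
      0≤z : 0ℚ ≤ z
      0≤z = 0≤w Y 0

      1≤z : 1ℚ ≤ z
      1≤z = 1≤w {Y} {0} z≤n

      sz≤W₁ : s * z ≤ W₁
      sz≤W₁ = subst (_≤ W₁) (trans (∑-* bins z _) (trans (cong (z *_) (sym s≡)) (*-comm z s)))
        (∑-mono bins step)
        where
        step : ∀ i → z * 𝟙 (σ i) ≤ 𝟙 (σ i) * w (a i) (b i)
        step i with σ i in eq
        ... | false = ≤-reflexive (solve 2 (λ z x → z :* con 0ℚ := con 0ℚ :* x) refl z (w (a i) (b i)))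
        ... | true  = ≤-trans (≤-reflexive (*-comm z 1ℚ))
          (*-monoˡ (0≤const 1ℚ) (w-mono {Y} {0} (ℕ.≤-trans (above i eq) (ℕ.≤-reflexive (sym (ℕ.+-identityʳ (a i)))))))

      w≤z : ∀ {i} → σ i ≡ false → w (a i) (b i) ≤ z
      w≤z {i} eq = w-mono {a i} {b i} {Y} {0} (ℕ.≤-trans (ℕ.≤-reflexive (ℕ.+-identityʳ (a i))) (below i eq))

      ∑not : ∑ bins (λ i → 𝟙 (not (σ i))) ≡ N - s
      ∑not = trans (solve 2 (λ x s → x := s :+ x :- s) refl _ s) (cong (_- s) (trans (cong (_+ _) s≡)
        (trans (sym (∑-+ bins (𝟙 ∘ σ) (𝟙 ∘ not ∘ σ))) (trans (∑-cong bins (λ i → eq (σ i))) (sym N≡)))))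
        where
        eq : ∀ c → 𝟙 c + 𝟙 (not c) ≡ 1ℚ
        eq true  = refl
        eq false = refl

      W₀≤ : W₀ ≤ (N - s) * z
      W₀≤ = subst (W₀ ≤_) (trans (∑-* bins z _) (trans (cong (z *_) ∑not) (*-comm z (N - s))))
        (∑-mono bins step)
        where
        step : ∀ i → 𝟙 (not (σ i)) * w (a i) (b i) ≤ z * 𝟙 (not (σ i))
        step i with σ i in eq
        ... | true  = ≤-reflexive (solve 2 (λ z x → con 0ℚ :* x := z :* con 0ℚ) refl z (w (a i) (b i)))
        ... | false = ≤-trans (*-monoˡ (0≤const 1ℚ) (w≤z eq)) (≤-reflexive (*-comm 1ℚ z))

      V₁≤N : V₁ ≤ N
      V₁≤N = subst (V₁ ≤_) (sym N≡) (∑-mono bins step)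
        where
        step : ∀ i → 𝟙 (σ i) * w (b i) (a i) ≤ 1ℚ
        step i with σ i in eq
        ... | true  = ≤-trans (≤-reflexive (*-identityˡ _)) (w≤1 (ℕ.≤-trans (ℕ.m≤n+m (b i) Y) (above i eq)))
        ... | false = ≤-trans (≤-reflexive (*-zeroˡ (w (b i) (a i)))) (0≤const 1ℚ)

      low : Fin n → Bool
      low i = not (σ i) ∧ ⌊ a i ℕ.≤? b i ⌋

      ℓ : ℚ
      ℓ = ∑ bins (λ i → 𝟙 (low i))

      -- Each unmarked bin weighs at most z, and a low one at most 1, which saves z - 1.
      W₀≤-low : W₀ ≤ (N - s) * z - ℓ * (z - 1ℚ)
      W₀≤-low = subst (W₀ ≤_) sum (∑-mono bins step)
        where
        step : ∀ i → 𝟙 (not (σ i)) * w (a i) (b i) ≤ z * 𝟙 (not (σ i)) + (1ℚ - z) * 𝟙 (low i)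
        step i with σ i in eq
        ... | true  = ≤-reflexive (solve 2 (λ z x → con 0ℚ :* x := z :* con 0ℚ :+ (con 1ℚ :- z) :* con 0ℚ) refl z (w (a i) (b i)))
        ... | false with a i ℕ.≤? b i
        ...   | yes a≤b = ≤-by (slack (w≤1 a≤b))
          (solve 2 (λ z x → z :* con 1ℚ :+ (con 1ℚ :- z) :* con 1ℚ := con 1ℚ :* x :+ (con 1ℚ :- x)) refl z (w (a i) (b i)))
        ...   | no  _   = ≤-by (slack (w≤z eq))
          (solve 2 (λ z x → z :* con 1ℚ :+ (con 1ℚ :- z) :* con 0ℚ := con 1ℚ :* x :+ (z :- x)) refl z (w (a i) (b i)))
        sum : ∑ bins (λ i → z * 𝟙 (not (σ i)) + (1ℚ - z) * 𝟙 (low i)) ≡ (N - s) * z - ℓ * (z - 1ℚ)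
        sum = trans (∑-+ bins _ _) (trans (cong₂ _+_ (trans (∑-* bins z _) (cong (z *_) ∑not)) (∑-* bins (1ℚ - z) _))
          (solve 3 (λ t z l → z :* t :+ (con 1ℚ :- z) :* l := t :* z :- l :* (z :- con 1ℚ)) refl (N - s) z ℓ))

      -- Each low bin makes up for at most 2Y of the surplus sY of the marked bins.
      s≤2ℓ : 1 ℕ.≤ Y → (∀ i → b i ℕ.≤ a i ℕ.+ 2 ℕ.* Y) → s ≤ (ℤ.+ 2 / 1) * ℓ
      s≤2ℓ 1≤Y near = *-cancelʳ-≤-pos y {{positive 0<y}} (≤-by (slack total)
        (solve 4 (λ s l y B → con (ℤ.+ 2 / 1) :* l :* y := s :* y :+ (B :+ con (ℤ.+ 2 / 1) :* y :* l :- (B :+ y :* s))) refl s ℓ y (∑ bins (ι ∘ b))))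
        where
        y = ι Y
        0<y : 0ℚ < y
        0<y = <-≤-trans (positive⁻¹ 1ℚ) (ι-mono 1≤Y)
        -- Summed over all bins, this inequality loses its two totals by `balanced`, and s Y ≤ 2 Y ℓ
        -- remains.
        nat≤ : ∀ i → 𝟙 (σ i) * y + ι (b i) ≤ ι (a i) + (ℤ.+ 2 / 1) * y * 𝟙 (low i)
        nat≤ i with σ i in eq
        ... | true = ≤-trans (≤-reflexive (trans (cong (_+ ι (b i)) (*-identityˡ y)) (sym (ι-+ Y (b i)))))
          (≤-trans (ι-mono (above i eq)) (≤-reflexive
            (solve 2 (λ a y → a := a :+ con (ℤ.+ 2 / 1) :* y :* con 0ℚ) refl (ι (a i)) y)))
        ... | false with a i ℕ.≤? b i
        ...   | yes _ = ≤-trans (≤-reflexive (solve 2 (λ b y → con 0ℚ :* y :+ b := b) refl (ι (b i)) y))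
          (≤-trans (ι-mono (near i)) (≤-reflexive (trans (ι-+ (a i) (2 ℕ.* Y)) (cong (ι (a i) +_)
            (trans (ι-* 2 Y) (sym (*-identityʳ (ι 2 * y))))))))
        ...   | no a≰b = ≤-trans (≤-reflexive (solve 2 (λ b y → con 0ℚ :* y :+ b := b) refl (ι (b i)) y))
          (≤-trans (ι-mono (ℕ.<⇒≤ (ℕ.≰⇒> a≰b))) (≤-reflexive
            (solve 2 (λ a y → a := a :+ con (ℤ.+ 2 / 1) :* y :* con 0ℚ) refl (ι (a i)) y)))
        total : ∑ bins (ι ∘ b) + y * s ≤ ∑ bins (ι ∘ b) + (ℤ.+ 2 / 1) * y * ℓ
        total = subst₂ _≤_
          (trans (∑-+ bins _ _) (trans (cong (_+ ∑ bins (ι ∘ b)) (trans (∑-cong bins (λ i → *-comm (𝟙 (σ i)) y))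
            (trans (∑-* bins y _) (cong (y *_) (sym s≡))))) (+-comm (y * s) (∑ bins (ι ∘ b)))))
          (trans (∑-+ bins _ _) (cong₂ _+_ balanced (∑-* bins ((ℤ.+ 2 / 1) * y) _)))
          (∑-mono bins nat≤)

      0≤s : 0ℚ ≤ s
      0≤s = subst (0ℚ ≤_) (sym s≡) (∑-nonneg bins (λ i → 0≤𝟙 (σ i)))

      -- With ℓ ≥ s/2 the saving in `W₀≤-low` is at least (s/2)(z - 1); the stray s/2 is absorbed by
      -- N.
      W₀≤-half : s ≤ (ℤ.+ 2 / 1) * ℓ → W₀ ≤ (N - s - ½ * s) * z + N
      W₀≤-half s≤2ℓ = ≤-by (slack W₀≤-low ⊕ 0≤const ½ ⊗ slack s≤2ℓ ⊗ slack 1≤z ⊕ 0≤N-s/2)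
        (solve 5 (λ N s z l W → (N :- s :- con ½ :* s) :* z :+ N := W :+
          ((N :- s) :* z :- l :* (z :- con 1ℚ) :- W :+ con ½ :* (con (ℤ.+ 2 / 1) :* l :- s) :* (z :- con 1ℚ)
           :+ (con ½ :* (N :- s) :+ con ½ :* N)))
          refl N s z ℓ W₀)
        where
        0≤N : 0ℚ ≤ N
        0≤N = ≤-trans (0≤const 1ℚ) 1≤N
        0≤N-s/2 : 0ℚ ≤ ½ * (N - s) + ½ * N
        0≤N-s/2 = 0≤const ½ ⊗ subst (0ℚ ≤_) ∑not (∑-nonneg bins (λ i → 0≤𝟙 (not (σ i)))) ⊕ 0≤const ½ ⊗ 0≤N

      -- Completing the square: (z - 288 N)² / 576 = z²/576 - N z + 144 N² is nonnegative.
      Nz≤ : z * z ≤ V → N * z ≤ (ℤ.+ 1 / 576) * V + (ℤ.+ 144 / 1) * (N * N)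
      Nz≤ z²≤V = ≤-by (0≤const (ℤ.+ 1 / 576) ⊗ slack z²≤V
                       ⊕ 0≤const (ℤ.+ 1 / 576) ⊗ 0≤x² (z - (ℤ.+ 288 / 1) * N))
        (solve 3 (λ N z V → con (ℤ.+ 1 / 576) :* V :+ con (ℤ.+ 144 / 1) :* (N :* N) := N :* z :+
          (con (ℤ.+ 1 / 576) :* (V :- z :* z)
           :+ con (ℤ.+ 1 / 576) :* ((z :- con (ℤ.+ 288 / 1) :* N) :* (z :- con (ℤ.+ 288 / 1) :* N)))) refl N z V)

    drift-V : N * V₁ - s * V ≤ drift N V W
    drift-V = drift-opposite {N} {s} N≤3s 3s≤2N 1≤N 0≤W 0≤V V₁≤N

    drift-W : s * W - N * W₁ ≤ drift N W V
    drift-W = subst (λ x → s * x - N * W₁ ≤ drift N x V) (sym W≡) cases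
      where
      spread : N * z ≤ (ℤ.+ 1 / 576) * V + (ℤ.+ 144 / 1) * (N * N) → s * (W₁ + W₀) - N * W₁ ≤ drift N (W₁ + W₀) V
      spread = drift-spread {N} {s} N≤3s 3s≤2N 1≤N {z} {W₁} {W₀} {V} (subst (0ℚ ≤_) W≡ 0≤W)
        (≤-by (slack W₀≤ ⊕ 0≤s ⊗ 0≤z) (solve 4 (λ N s z W → N :* z := W :+ ((N :- s) :* z :- W :+ s :* z)) refl N s z W₀))
      cases : s * (W₁ + W₀) - N * W₁ ≤ drift N (W₁ + W₀) V
      cases with 1 ℕ.≤? Y | any? (λ i → a i ℕ.+ 2 ℕ.* Y ℕ.≤? b i)
      -- A bin lying 2Y below the average has opposite weight at least β^(2Y) = z², which bounds V
      -- from below.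
      ... | _ | yes (i , far) = spread (Nz≤ (≤-trans (≤-reflexive (sym (w-* Y 0 Y 0)))
            (≤-trans (w-mono {Y ℕ.+ Y} {0} {b i} {a i} (ℕ.≤-trans (ℕ.≤-reflexive (trans (ℕ.+-comm (Y ℕ.+ Y) (a i))
                (cong (λ x → a i ℕ.+ (Y ℕ.+ x)) (sym (ℕ.+-identityʳ Y))))) (ℕ.≤-trans far (ℕ.≤-reflexive (sym (ℕ.+-identityʳ (b i)))))))
              (∑-∈ (λ i → 0≤w (b i) (a i)) (∈-allFin i)))))
      ... | yes 1≤Y | no ¬far = drift-balanced N≤3s 3s≤2N 1≤N 0≤z 0≤V sz≤W₁ W₀≤
            (W₀≤-half (s≤2ℓ 1≤Y (λ i → ℕ.<⇒≤ (ℕ.≰⇒> (λ far → ¬far (i , far))))))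
      -- At Y = 0 the factor Y cannot be cancelled as in `s≤2ℓ`, but then z = 1 and N ≤ N² is enough
      -- for the spread case.
      ... | no  1≰Y | no _ = spread (subst (λ x → N * x ≤ _) (sym z≡1)
            (≤-by (0≤const (ℤ.+ 1 / 576) ⊗ 0≤V ⊕ 0≤N ⊗ slack 1≤N ⊕ 0≤const (ℤ.+ 143 / 1) ⊗ 0≤N ⊗ 0≤N)
              (solve 2 (λ N V → con (ℤ.+ 1 / 576) :* V :+ con (ℤ.+ 144 / 1) :* (N :* N)
                := N :* con 1ℚ :+ (con (ℤ.+ 1 / 576) :* V :+ N :* (N :- con 1ℚ) :+ con (ℤ.+ 143 / 1) :* N :* N)) refl N V)))
        where
        0≤N : 0ℚ ≤ N
        0≤N = ≤-trans (0≤const 1ℚ) 1≤N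
        z≡1 : z ≡ 1ℚ
        z≡1 = cong (λ y → w y 0) (ℕ.n<1⇒n≡0 (ℕ.≰⇒> 1≰Y))

-- Numerical bounds for one step, second-order terms included.

bernoulli : ∀ {x} k → 0ℚ ≤ x → 1ℚ + ι k * x ≤ (1ℚ + x) ^ k
bernoulli {x} zero    0≤x = ≤-reflexive (solve 1 (λ x → con 1ℚ :+ con 0ℚ :* x := con 1ℚ) refl x)
bernoulli {x} (suc k) 0≤x = ≤-trans
  (≤-by (0≤ι k ⊗ 0≤x² x) (solve 2 (λ k x → (con 1ℚ :+ x) :* (con 1ℚ :+ k :* x)
    := con 1ℚ :+ (con 1ℚ :+ k) :* x :+ k :* (x :* x)) refl (ι k) x))
  (*-monoˡ (0≤const 1ℚ ⊕ 0≤x) (bernoulli k 0≤x))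

module Rate {N h β γ : ℚ} (1≤N : 1ℚ ≤ N) (Nh : N * h ≡ ℤ.+ 1 / 50) (0≤h : 0ℚ ≤ h)
  (0≤γ : 0ℚ ≤ γ) (β≡ : β ≡ 1ℚ + h) (βγ≡1 : β * γ ≡ 1ℚ) where

  0≤N : 0ℚ ≤ N
  0≤N = ≤-trans (0≤const 1ℚ) 1≤N

  1≤β : 1ℚ ≤ β
  1≤β = ≤-by 0≤h β≡

  0≤β : 0ℚ ≤ β
  0≤β = ≤-trans (0≤const 1ℚ) 1≤β

  γ+γh≡1 : γ + γ * h ≡ 1ℚ
  γ+γh≡1 = trans (trans (solve 2 (λ γ h → γ :+ γ :* h := (con 1ℚ :+ h) :* γ) refl γ h) (cong (_* γ) (sym β≡))) βγ≡1

  γ≤1 : γ ≤ 1ℚ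
  γ≤1 = ≤-by (0≤γ ⊗ 0≤h) (sym γ+γh≡1)

  1-h≤γ : 1ℚ - h ≤ γ
  1-h≤γ = ≤-by (slack γ≤1 ⊗ 0≤h) (trans (solve 2 (λ γ h → γ := γ :+ γ :* h :- γ :* h) refl γ h) (trans
    (cong (_- γ * h) γ+γh≡1)
    (solve 2 (λ γ h → con 1ℚ :- γ :* h := con 1ℚ :- h :+ (con 1ℚ :- γ) :* h) refl γ h)))

  h≤1/50 : h ≤ ℤ.+ 1 / 50
  h≤1/50 = ≤-by (slack 1≤N ⊗ 0≤h) (trans (sym Nh)
    (solve 2 (λ N h → N :* h := h :+ (N :- con 1ℚ) :* h) refl N h))

  ½≤γ : ½ ≤ γ
  ½≤γ = ≤-trans (≤-by (slack h≤1/50 ⊕ 0≤const (ℤ.+ 24 / 50))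
    (solve 1 (λ h → con 1ℚ :- h := con ½ :+ (con (ℤ.+ 1 / 50) :- h :+ con (ℤ.+ 24 / 50))) refl h)) 1-h≤γ

  β≤2 : β ≤ ℤ.+ 2 / 1
  β≤2 = subst (_≤ ℤ.+ 2 / 1) (sym β≡) (≤-by (slack h≤1/50 ⊕ 0≤const (ℤ.+ 49 / 50))
    (solve 1 (λ h → con (ℤ.+ 2 / 1) := con 1ℚ :+ h :+ (con (ℤ.+ 1 / 50) :- h :+ con (ℤ.+ 49 / 50))) refl h))

  γ^k≤1 : ∀ k → γ ^ k ≤ 1ℚ
  γ^k≤1 zero    = ≤-refl
  γ^k≤1 (suc k) = ≤-trans (*-mono-≤ 0≤γ (0≤const 1ℚ) γ≤1 (γ^k≤1 k)) (≤-reflexive (*-identityˡ 1ℚ))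

  γ-bernoulli : ∀ k → 1ℚ - ι k * h ≤ γ ^ k
  γ-bernoulli zero    = ≤-reflexive (solve 1 (λ h → con 1ℚ :- con 0ℚ :* h := con 1ℚ) refl h)
  γ-bernoulli (suc k) = ≤-by (slack (γ-bernoulli k) ⊕ slack 1-h≤γ ⊕ slack (γ^k≤1 k) ⊗ slack γ≤1)
    (solve 4 (λ k h g γ → γ :* g := con 1ℚ :- (con 1ℚ :+ k) :* h :+
      (g :- (con 1ℚ :- k :* h) :+ (γ :- (con 1ℚ :- h)) :+ (con 1ℚ :- g) :* (con 1ℚ :- γ))) refl (ι k) h (γ ^ k) γ)

  pow-inverse : ∀ k → β ^ k * γ ^ k ≡ 1ℚ
  pow-inverse zero    = refl
  pow-inverse (suc k) = trans (solve 4 (λ b B g G → b :* B :* (g :* G) := b :* g :* (B :* G)) refl β (β ^ k) γ (γ ^ k))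
    (cong₂ _*_ βγ≡1 (pow-inverse k))

  module _ (n : ℕ) (N≡ : N ≡ ι n) where

    -- An upper bound on a power comes from a lower bound on its reciprocal: γⁿ ≥ 1 - n h = 49/50.
    -- The bound on γⁿ arises likewise from βⁿ ≥ 51/50.
    β^n≤ : β ^ n ≤ ℤ.+ 50 / 49
    β^n≤ = ≤-by (0≤const (ℤ.+ 50 / 49) ⊗ 0≤pow n 0≤β ⊗ slack lower)
      (trans (cong ((ℤ.+ 50 / 49) *_) (sym (pow-inverse n)))
        (solve 2 (λ B G → con (ℤ.+ 50 / 49) :* (B :* G) := B :+ con (ℤ.+ 50 / 49) :* B :* (G :- con (ℤ.+ 49 / 50))) refl (β ^ n) (γ ^ n)))
      where
      lower : ℤ.+ 49 / 50 ≤ γ ^ n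
      lower = subst (_≤ γ ^ n) (cong (λ x → 1ℚ - x) (trans (cong (_* h) (sym N≡)) Nh)) (γ-bernoulli n)

    γ^n≤ : γ ^ n ≤ ℤ.+ 50 / 51
    γ^n≤ = ≤-by (0≤const (ℤ.+ 50 / 51) ⊗ 0≤pow n 0≤γ ⊗ slack lower)
      (trans (cong ((ℤ.+ 50 / 51) *_) (sym (pow-inverse n)))
        (solve 2 (λ B G → con (ℤ.+ 50 / 51) :* (B :* G) := G :+ con (ℤ.+ 50 / 51) :* G :* (B :- con (ℤ.+ 51 / 50))) refl (β ^ n) (γ ^ n)))
      where
      lower : ℤ.+ 51 / 50 ≤ β ^ n
      lower = subst₂ _≤_ (cong (1ℚ +_) (trans (cong (_* h) (sym N≡)) Nh)) (cong (_^ n) (sym β≡)) (bernoulli n 0≤h)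

  -- `E` and `F` stand for n² times the mean weight of the chosen bin in Φ and in Ψ. `B` and `G`
  -- stand for βⁿ and γⁿ, the factors that the new ball puts on these weights. Sums over the 2n²
  -- samples replace expectations.
  module _ {Φ Ψ E F B G : ℚ} (0≤Φ : 0ℚ ≤ Φ) (0≤Ψ : 0ℚ ≤ Ψ)
    (0≤E : 0ℚ ≤ E) (E≤ : E ≤ (ℤ.+ 2 / 1) * N * Φ) (0≤F : 0ℚ ≤ F) (F≤ : F ≤ (ℤ.+ 2 / 1) * N * Ψ)
    (B≤ : B ≤ ℤ.+ 50 / 49) (G≤ : G ≤ ℤ.+ 50 / 51) where

    private
      -- The first-order part has coefficient 2 N h = 1/25. The error 1/49 - 1/50 = 1/2450 in B - 1
      -- costs at most 2NΦ/1225, which fits into NΦ/600 = (1/25)(1/24)NΦ.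
      up-step : γ * ((ℤ.+ 2 / 1) * (N * N) * Φ + (B - 1ℚ) * ((ℤ.+ 2 / 1) * E))
              ≤ (ℤ.+ 2 / 1) * (N * N) * Φ + (ℤ.+ 1 / 25) * γ * (E - N * Φ + (ℤ.+ 1 / 24) * N * Φ)
      up-step = ≤-by (0≤const (ℤ.+ 2 / 1) ⊗ 0≤N ⊗ 0≤Φ ⊗ slack Nγ≤
                      ⊕ 0≤γ ⊗ (0≤const (ℤ.+ 2 / 1) ⊗ slack B≤ ⊗ 0≤E ⊕ 0≤const (ℤ.+ 1 / 1225) ⊗ slack E≤
                               ⊕ 0≤const (ℤ.+ 1 / 29400) ⊗ 0≤N ⊗ 0≤Φ))
        (solve 5 (λ N γ B E Φ → con (ℤ.+ 2 / 1) :* (N :* N) :* Φ :+ con (ℤ.+ 1 / 25) :* γ :* (E :- N :* Φ :+ con (ℤ.+ 1 / 24) :* N :* Φ)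
          := γ :* (con (ℤ.+ 2 / 1) :* (N :* N) :* Φ :+ (B :- con 1ℚ) :* (con (ℤ.+ 2 / 1) :* E))
          :+ (con (ℤ.+ 2 / 1) :* N :* Φ :* (N :- con (ℤ.+ 1 / 50) :* γ :- N :* γ)
              :+ γ :* (con (ℤ.+ 2 / 1) :* (con (ℤ.+ 50 / 49) :- B) :* E :+ con (ℤ.+ 1 / 1225) :* (con (ℤ.+ 2 / 1) :* N :* Φ :- E)
                       :+ con (ℤ.+ 1 / 29400) :* N :* Φ))) refl N γ B E Φ)
        where
        Nγ≤ : N * γ ≤ N - (ℤ.+ 1 / 50) * γ
        Nγ≤ = ≤-reflexive (trans (solve 3 (λ N γ h → N :* γ := N :* (γ :+ γ :* h) :- N :* h :* γ) refl N γ h)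
          (cong₂ (λ x y → x - y * γ) (trans (cong (N *_) γ+γh≡1) (*-identityʳ N)) Nh))

      -- Here the error is 1/50 - 1/51 = 1/2550, and its cost 2NΨ/1275 is again below NΨ/600.
      down-step : β * ((ℤ.+ 2 / 1) * (N * N) * Ψ - (1ℚ - G) * ((ℤ.+ 2 / 1) * F))
                ≤ (ℤ.+ 2 / 1) * (N * N) * Ψ + (ℤ.+ 1 / 25) * β * (N * Ψ - F + (ℤ.+ 1 / 24) * N * Ψ)
      down-step = ≤-by (0≤const (ℤ.+ 2 / 1) ⊗ 0≤N ⊗ 0≤Ψ ⊗ slack Nβ≤
                        ⊕ 0≤const (ℤ.+ 1 / 25) ⊗ slack 1≤β ⊗ (0≤N ⊗ 0≤Ψ)
                        ⊕ 0≤β ⊗ (0≤const (ℤ.+ 2 / 1) ⊗ slack G≤ ⊗ 0≤F ⊕ 0≤const (ℤ.+ 1 / 1275) ⊗ slack F≤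
                               ⊕ 0≤const (ℤ.+ 1 / 10200) ⊗ 0≤N ⊗ 0≤Ψ))
        (solve 5 (λ N β G F Ψ → con (ℤ.+ 2 / 1) :* (N :* N) :* Ψ :+ con (ℤ.+ 1 / 25) :* β :* (N :* Ψ :- F :+ con (ℤ.+ 1 / 24) :* N :* Ψ)
          := β :* (con (ℤ.+ 2 / 1) :* (N :* N) :* Ψ :- (con 1ℚ :- G) :* (con (ℤ.+ 2 / 1) :* F))
          :+ (con (ℤ.+ 2 / 1) :* N :* Ψ :* (N :+ con (ℤ.+ 1 / 50) :- N :* β)
              :+ con (ℤ.+ 1 / 25) :* (β :- con 1ℚ) :* (N :* Ψ)
              :+ β :* (con (ℤ.+ 2 / 1) :* (con (ℤ.+ 50 / 51) :- G) :* F :+ con (ℤ.+ 1 / 1275) :* (con (ℤ.+ 2 / 1) :* N :* Ψ :- F)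
                       :+ con (ℤ.+ 1 / 10200) :* N :* Ψ))) refl N β G F Ψ)
        where
        Nβ≤ : N * β ≤ N + ℤ.+ 1 / 50
        Nβ≤ = ≤-reflexive (trans (cong (N *_) β≡) (trans
          (solve 2 (λ N h → N :* (con 1ℚ :+ h) := N :+ N :* h) refl N h) (cong (N +_) Nh)))

    -- Decay 1/18 less the second-order loss 1/24 leaves 1/72. For Φ, γ ≥ 1/2 keeps 1/144 of it and
    -- β ≤ 2 lets the cross term take 1/288, so 1/288 remains; times 1/25 this is 1/7200. Ψ has room
    -- to spare. The cubic terms total at most 145 + 290 ≤ 450 = 25 · 18.
    step-bound : E - N * Φ ≤ drift N Φ Ψ → N * Ψ - F ≤ drift N Ψ Φ →
        γ * ((ℤ.+ 2 / 1) * (N * N) * Φ + (B - 1ℚ) * ((ℤ.+ 2 / 1) * E))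
        + β * ((ℤ.+ 2 / 1) * (N * N) * Ψ - (1ℚ - G) * ((ℤ.+ 2 / 1) * F))
      ≤ ((ℤ.+ 2 / 1) * (N * N) - (ℤ.+ 1 / 7200) * N) * (Φ + Ψ) + (ℤ.+ 18 / 1) * (N * N * N)
    step-bound dΦ dΨ = ≤-trans (+-mono-≤ up-step down-step)
      (≤-by (0≤const (ℤ.+ 1 / 25) ⊗
              (0≤γ ⊗ slack dΦ ⊕ 0≤β ⊗ slack dΨ
               ⊕ slack γ≤1 ⊗ (0≤const (ℤ.+ 1 / 576) ⊗ 0≤N ⊗ 0≤Ψ ⊕ 0≤const (ℤ.+ 145 / 1) ⊗ 0≤N³)
               ⊕ slack ½≤γ ⊗ (0≤const (ℤ.+ 1 / 72) ⊗ 0≤N ⊗ 0≤Φ)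
               ⊕ slack β≤2 ⊗ (0≤const (ℤ.+ 1 / 576) ⊗ 0≤N ⊗ 0≤Φ ⊕ 0≤const (ℤ.+ 145 / 1) ⊗ 0≤N³)
               ⊕ slack 1≤β ⊗ (0≤const (ℤ.+ 1 / 72) ⊗ 0≤N ⊗ 0≤Ψ)
               ⊕ 0≤const (ℤ.+ 5 / 576) ⊗ 0≤N ⊗ 0≤Ψ
               ⊕ 0≤const (ℤ.+ 15 / 1) ⊗ 0≤N³))
        (solve 7 (λ N γ β E F Φ Ψ →
          (con (ℤ.+ 2 / 1) :* (N :* N) :- con (ℤ.+ 1 / 7200) :* N) :* (Φ :+ Ψ) :+ con (ℤ.+ 18 / 1) :* (N :* N :* N)
          := con (ℤ.+ 2 / 1) :* (N :* N) :* Φ :+ con (ℤ.+ 1 / 25) :* γ :* (E :- N :* Φ :+ con (ℤ.+ 1 / 24) :* N :* Φ)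
          :+ (con (ℤ.+ 2 / 1) :* (N :* N) :* Ψ :+ con (ℤ.+ 1 / 25) :* β :* (N :* Ψ :- F :+ con (ℤ.+ 1 / 24) :* N :* Ψ))
          :+ con (ℤ.+ 1 / 25) :*
             (γ :* (con (ℤ.+ 1 / 576) :* N :* Ψ :+ con (ℤ.+ 145 / 1) :* (N :* N :* N) :- con (ℤ.+ 1 / 18) :* N :* Φ :- (E :- N :* Φ))
              :+ β :* (con (ℤ.+ 1 / 576) :* N :* Φ :+ con (ℤ.+ 145 / 1) :* (N :* N :* N) :- con (ℤ.+ 1 / 18) :* N :* Ψ :- (N :* Ψ :- F))
              :+ (con 1ℚ :- γ) :* (con (ℤ.+ 1 / 576) :* N :* Ψ :+ con (ℤ.+ 145 / 1) :* (N :* N :* N))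
              :+ (γ :- con ½) :* (con (ℤ.+ 1 / 72) :* N :* Φ)
              :+ (con (ℤ.+ 2 / 1) :- β) :* (con (ℤ.+ 1 / 576) :* N :* Φ :+ con (ℤ.+ 145 / 1) :* (N :* N :* N))
              :+ (β :- con 1ℚ) :* (con (ℤ.+ 1 / 72) :* N :* Ψ)
              :+ con (ℤ.+ 5 / 576) :* N :* Ψ
              :+ con (ℤ.+ 15 / 1) :* (N :* N :* N))) refl N γ β E F Φ Ψ))
      where
      0≤N³ : 0ℚ ≤ N * N * N
      0≤N³ = 0≤N ⊗ 0≤N ⊗ 0≤N

-- Counting bins by rank and averaging over samples.

∑-const-bins : ∀ n c → ∑ (allFin n) (λ _ → c) ≡ c * ι n
∑-const-bins n c = trans (∑-const (allFin n) c) (cong (λ k → c * ι k) (length-tabulate {n = n} id))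

∑-bins : ∀ n → ι n ≡ ∑ (allFin n) (λ _ → 1ℚ)
∑-bins n = sym (trans (∑-const-bins n 1ℚ) (*-identityˡ (ι n)))

∑-suc : ∀ n (f : Fin (suc n) → ℚ) → ∑ (allFin (suc n)) f ≡ f Fin.zero + ∑ (allFin n) (λ i → f (Fin.suc i))
∑-suc n f = cong (f Fin.zero +_) (trans (cong (λ xs → ∑ xs f) (sym (map-tabulate id Fin.suc)))
  (∑-map Fin.suc (allFin n) f))

count-≥ : ∀ {n d} → d ℕ.≤ n → ∑ (allFin n) (λ i → 𝟙 ⌊ d ℕ.≤? toℕ i ⌋) ≡ ι n - ι d
count-≥ {n} {zero}  d≤n       = trans (sym (∑-bins n)) (solve 1 (λ x → x := x :- con 0ℚ) refl (ι n))
count-≥ {suc n} {suc d} (s≤s d≤n) = trans (∑-suc n (λ i → 𝟙 ⌊ suc d ℕ.≤? toℕ i ⌋)) (trans (cong (0ℚ +_)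
    (trans (∑-cong (allFin n) (λ i → cong 𝟙 (shift d (toℕ i)))) (count-≥ d≤n)))
  (solve 2 (λ n d → con 0ℚ :+ (n :- d) := con 1ℚ :+ n :- (con 1ℚ :+ d)) refl (ι n) (ι d)))
  where
  shift : ∀ d k → ⌊ suc d ℕ.≤? suc k ⌋ ≡ ⌊ d ℕ.≤? k ⌋
  shift zero    k = refl
  shift (suc d) k = trans (isYes≗does (2 ℕ.+ d ℕ.≤? suc k)) (sym (isYes≗does (suc d ℕ.≤? k)))

-- Injectivity gives ≤ by `∑-⊆`. The same bound for 1 - f, whose sums are complements to n, gives ≥.
∑-injective : ∀ {n} {r : Fin n → Fin n} {f : Fin n → ℚ} → (∀ i j → r i ≡ r j → i ≡ j) →
  (∀ i → 0ℚ ≤ f i) → (∀ i → f i ≤ 1ℚ) → ∑ (allFin n) (λ i → f (r i)) ≡ ∑ (allFin n) f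
∑-injective {n} {r} {f} inj 0≤f f≤1 = ≤-antisym (le f 0≤f) (≤-by (slack (le (λ i → 1ℚ - f i) (λ i → slack (f≤1 i))))
    (trans (solve 3 (λ N x y → x := y :+ (N :- y :- (N :- x))) refl (ι n) (∑ (allFin n) (f ∘ r)) (∑ (allFin n) f))
      (cong (_+_ (∑ (allFin n) f)) (cong₂ _-_ (complement f) (complement (f ∘ r))))))
  where
  le : ∀ g → (∀ i → 0ℚ ≤ g i) → ∑ (allFin n) (g ∘ r) ≤ ∑ (allFin n) g
  le g 0≤g = subst (_≤ ∑ (allFin n) g) (∑-map r (allFin n) g)
    (∑-⊆ 0≤g (map⁺ (inj _ _) (allFin⁺ n)) (λ {i} _ → ∈-allFin i))
  complement : ∀ g → ι n - ∑ (allFin n) g ≡ ∑ (allFin n) (λ i → 1ℚ - g i)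
  complement g = trans (cong (_- ∑ (allFin n) g) (∑-bins n)) (trans
    (solve 2 (λ x y → x :- y := x :+ con (- 1ℚ) :* y) refl (∑ (allFin n) (λ _ → 1ℚ)) (∑ (allFin n) g))
    (trans (cong (_+_ (∑ (allFin n) (λ _ → 1ℚ))) (sym (∑-* (allFin n) (- 1ℚ) g)))
    (trans (sym (∑-+ (allFin n) (λ _ → 1ℚ) (λ i → - 1ℚ * g i)))
      (∑-cong (allFin n) (λ i → solve 1 (λ x → con 1ℚ :+ con (- 1ℚ) :* x := con 1ℚ :- x) refl (g i))))))

∑-addBall : ∀ {n} (x : Loads n) k (f : ℕ → ℚ) →
  ∑ (allFin n) (λ i → f (addBall x k i)) ≡ ∑ (allFin n) (λ i → f (x i)) + (f (suc (x k)) - f (x k))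
∑-addBall {n} x k f = trans (∑-update (allFin⁺ n) (∈-allFin k) (λ i≢k → cong f (off i≢k)))
  (cong (λ y → ∑ (allFin n) (f ∘ x) + (f y - f (x k))) on)
  where
  on : addBall x k k ≡ suc (x k)
  on with k Fin.≟ k
  ... | yes _   = refl
  ... | no  k≢k = ⊥-elim (k≢k refl)
  off : ∀ {i} → i ≢ k → addBall x k i ≡ x i
  off {i} i≢k with i Fin.≟ k
  ... | yes i≡k = ⊥-elim (i≢k i≡k)
  ... | no  _   = refl

samples : ∀ n → List (Sample n)
samples n = cartesianProduct (allFin n) (cartesianProduct (allFin n) (true ∷ false ∷ []))

∑-samples : ∀ {n} (f : Sample n → ℚ) → ∑ (samples n) f ≡
  ∑ (allFin n) (λ i → ∑ (allFin n) (λ j → f (i , j , true) + (f (i , j , false) + 0ℚ)))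
∑-samples {n} f = trans (∑-cartesianProduct (allFin n) _ f)
  (∑-cong (allFin n) (λ i → ∑-cartesianProduct (allFin n) _ (λ s → f (i , s))))

∑-samples-const : ∀ n c → ∑ (samples n) (λ _ → c) ≡ (ℤ.+ 2 / 1) * (ι n * ι n) * c
∑-samples-const n c = trans (∑-samples {n} (λ _ → c)) (trans
  (∑-cong (allFin n) (λ _ → ∑-const-bins n (c + (c + 0ℚ))))
  (trans (∑-const-bins n ((c + (c + 0ℚ)) * ι n))
    (solve 2 (λ n c → (c :+ (c :+ con 0ℚ)) :* n :* n := con (ℤ.+ 2 / 1) :* (n :* n) :* c) refl (ι n) c)))

-- Write l for the light indicator. Over both coin values, the pair (i, j) selects i exactly 1 + l i
-- - l j times and j exactly 1 + l j - l i times. The two halves have equal sums, and summing over j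
-- gives bin i the multiplicity n (1 + l i) - (n - D) = D + n l i.
∑-choose : ∀ {n} d (r : Rank n) (F : Fin n → ℚ) {D} →
  ∑ (allFin n) (λ i → 𝟙 (light d r i)) ≡ ι n - D →
  ∑ (samples n) (λ s → F (choose d r s)) ≡
  (ℤ.+ 2 / 1) * (D * ∑ (allFin n) F + ι n * ∑ (allFin n) (λ i → 𝟙 (light d r i) * F i))
∑-choose {n} d r F {D} count = begin
  ∑ (samples n) (λ s → F (choose d r s))
    ≡⟨ trans (∑-samples {n} (λ s → F (choose d r s))) (∑-cong bins (λ i → trans (∑-cong bins (pair i)) (∑-+ bins (T i) (λ j → T j i)))) ⟩
  ∑ bins (λ i → ∑ bins (T i) + ∑ bins (λ j → T j i))
    ≡⟨ trans (∑-+ bins (λ i → ∑ bins (T i)) (λ i → ∑ bins (λ j → T j i))) (cong (_+_ (∑ bins (λ i → ∑ bins (T i)))) (sym (∑-swap bins bins T))) ⟩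
  ∑ bins (λ i → ∑ bins (T i)) + ∑ bins (λ i → ∑ bins (T i))
    ≡⟨ cong₂ _+_ total total ⟩
  (D * ∑ bins F + ι n * FL) + (D * ∑ bins F + ι n * FL)
    ≡⟨ solve 1 (λ x → x :+ x := con (ℤ.+ 2 / 1) :* x) refl (D * ∑ bins F + ι n * FL) ⟩
  (ℤ.+ 2 / 1) * (D * ∑ bins F + ι n * FL) ∎
  where
  open ≡-Reasoning
  bins = allFin n
  lt : Fin n → ℚ
  lt i = 𝟙 (light d r i)
  FL = ∑ bins (λ i → lt i * F i)
  T : Fin n → Fin n → ℚ
  T i j = F i * (1ℚ + lt i - lt j)
  pair : ∀ i j → F (choose d r (i , j , true)) + (F (choose d r (i , j , false)) + 0ℚ) ≡ T i j + T j i
  pair i j with light d r i | light d r j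
  ... | true  | true  = solve 2 (λ x y → x :+ (y :+ con 0ℚ) := x :* (con 1ℚ :+ con 1ℚ :- con 1ℚ) :+ y :* (con 1ℚ :+ con 1ℚ :- con 1ℚ)) refl (F i) (F j)
  ... | true  | false = solve 2 (λ x y → x :+ (x :+ con 0ℚ) := x :* (con 1ℚ :+ con 1ℚ :- con 0ℚ) :+ y :* (con 1ℚ :+ con 0ℚ :- con 1ℚ)) refl (F i) (F j)
  ... | false | true  = solve 2 (λ x y → y :+ (y :+ con 0ℚ) := x :* (con 1ℚ :+ con 0ℚ :- con 1ℚ) :+ y :* (con 1ℚ :+ con 1ℚ :- con 0ℚ)) refl (F i) (F j)
  ... | false | false = solve 2 (λ x y → x :+ (y :+ con 0ℚ) := x :* (con 1ℚ :+ con 0ℚ :- con 0ℚ) :+ y :* (con 1ℚ :+ con 0ℚ :- con 0ℚ)) refl (F i) (F j)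
  row : ∀ i → ∑ bins (T i) ≡ D * F i + ι n * (lt i * F i)
  row i = trans (∑-* bins (F i) _) (trans (cong (F i *_)
      (trans (∑-cong bins (λ j → solve 2 (λ x y → con 1ℚ :+ x :- y := (con 1ℚ :+ x) :* con 1ℚ :+ con (- 1ℚ) :* y) refl (lt i) (lt j)))
        (trans (∑-+ bins _ _) (cong₂ _+_ (trans (∑-* bins (1ℚ + lt i) _) (cong ((1ℚ + lt i) *_) (sym (∑-bins n))))
          (trans (∑-* bins (- 1ℚ) _) (cong (- 1ℚ *_) count))))))
    (solve 4 (λ F l N D → F :* ((con 1ℚ :+ l) :* N :+ con (- 1ℚ) :* (N :- D)) := D :* F :+ N :* (l :* F)) refl (F i) (lt i) (ι n) D))
  total : ∑ bins (λ i → ∑ bins (T i)) ≡ D * ∑ bins F + ι n * FL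
  total = trans (∑-cong bins row) (trans (∑-+ bins _ _) (cong₂ _+_ (∑-* bins D F) (∑-* bins (ι n) _)))

-- The witness τ is the largest load of a light bin, or 0 if there is none.
threshold : ∀ {n} (x : Loads n) (l : Fin n → Bool) →
  (∀ i j → l i ≡ false → l j ≡ true → x j ℕ.≤ x i) →
  ∃ λ τ → (∀ i → l i ≡ false → τ ℕ.≤ x i) × (∀ i → l i ≡ true → x i ℕ.≤ τ)
threshold {n} x l sep = let τ , lower , upper = go (allFin n) in τ , lower , λ i eq → upper eq (∈-allFin i)
  where
  go : ∀ is → ∃ λ τ → (∀ i → l i ≡ false → τ ℕ.≤ x i) × (∀ {i} → l i ≡ true → i ∈ is → x i ℕ.≤ τ)
  go []       = 0 , (λ _ _ → z≤n) , λ _ ()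
  go (j ∷ is) with l j in eq | go is
  ... | true  | τ , lower , upper = x j ℕ.⊔ τ
    , (λ i h → ℕ.⊔-lub (sep i j h eq) (lower i h))
    , λ { _ (here refl) → ℕ.m≤m⊔n (x j) τ ; h (there i∈is) → ℕ.≤-trans (upper h i∈is) (ℕ.m≤n⊔m (x j) τ) }
  ... | false | τ , lower , upper = τ , lower
    , λ { h (here refl) → contr (trans (sym h) eq) ; h (there i∈is) → upper h i∈is }
    where
    contr : ∀ {A : Set} → true ≡ false → A
    contr ()

module _ {n d : ℕ} {x : Loads n} {r : Rank n} (ranking : IsRanking x r) where
  open IsRanking ranking

  -- By injectivity of the ranking, the light bins can be counted by their ranks, as in `count-≥`.
  count-light : d ℕ.≤ n → ∑ (allFin n) (λ i → 𝟙 (light d r i)) ≡ ι n - ι d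
  count-light d≤n = trans (∑-injective injective (λ i → 0≤𝟙 ⌊ d ℕ.≤? toℕ i ⌋) (λ i → 𝟙≤1 ⌊ d ℕ.≤? toℕ i ⌋)) (count-≥ d≤n)
    where
    𝟙≤1 : ∀ b → 𝟙 b ≤ 1ℚ
    𝟙≤1 true  = ≤-refl
    𝟙≤1 false = 0≤const 1ℚ

  light-below : ∀ i j → light d r i ≡ false → light d r j ≡ true → x j ℕ.≤ x i
  light-below i j hi lj with d ℕ.≤? toℕ (r i) | d ℕ.≤? toℕ (r j)
  light-below i j () lj | yes _ | _
  light-below i j hi () | no _  | no _
  light-below i j hi lj | no d≰ri | yes d≤rj =
    ℕ.≮⇒≥ (λ xi<xj → d≰ri (ℕ.≤-trans d≤rj (ℕ.<⇒≤ (monotone j i xi<xj))))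

-- The process

∑-loads : ∀ {n} d (rule : TieRule n) h → ∑ (allFin n) (λ i → ι (loads d rule h i)) ≡ ι (length h)
∑-loads {n} d rule []      = trans (∑-const (allFin n) 0ℚ) (*-zeroˡ (ι (length (allFin n))))
∑-loads {n} d rule (s ∷ h) = trans (∑-addBall (loads d rule h) (choose d (rule h) s) ι)
  (trans (cong (_+ (1ℚ + k - k)) (∑-loads d rule h)) (solve 2 (λ t k → t :+ (con 1ℚ :+ k :- k) := con 1ℚ :+ t) refl (ι (length h)) k))
  where k = ι (loads d rule h (choose d (rule h) s))

-- These are the (2n²)^m equally likely outcomes, so an expectation is a sum over this list divided
-- by (2n²)^m.
histories : ∀ n → ℕ → List (List (Sample n))
histories n zero    = [] ∷ []
histories n (suc m) = concatMap (λ h → map (_∷ h) (samples n)) (histories n m)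

∑-histories-suc : ∀ n m (f : List (Sample n) → ℚ) →
  ∑ (histories n (suc m)) f ≡ ∑ (histories n m) (λ h → ∑ (samples n) (λ s → f (s ∷ h)))
∑-histories-suc n m f = trans (∑-concatMap (λ h → map (_∷ h) (samples n)) (histories n m) f)
  (∑-cong (histories n m) (λ h → ∑-map (_∷ h) (samples n) f))

∈-samples : ∀ {n} (s : Sample n) → s ∈ samples n
∈-samples (i , j , b) = ∈-cartesianProduct⁺ (∈-allFin i) (∈-cartesianProduct⁺ (∈-allFin j) (∈-bool b))
  where
  ∈-bool : ∀ b → b ∈ true ∷ false ∷ []
  ∈-bool true  = here refl
  ∈-bool false = there (here refl)

∈-histories : ∀ {n} (h : List (Sample n)) → h ∈ histories n (length h)
∈-histories []          = here refl
∈-histories {n} (s ∷ h) = ∈-concatMap⁺ (λ h → map (_∷ h) (samples n))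
  (Any.map (λ { refl → ∈-map⁺ (_∷ h) (∈-samples s) }) (∈-histories h))

-- The potentials along the process.

module Potential {n : ℕ} (1≤n : 1 ℕ.≤ n) {h β γ : ℚ} (Nh : ι n * h ≡ ℤ.+ 1 / 50) (0≤h : 0ℚ ≤ h)
  (0≤γ : 0ℚ ≤ γ) (β≡ : β ≡ 1ℚ + h) (βγ≡1 : β * γ ≡ 1ℚ) where

  N : ℚ
  N = ι n

  private
    bins = allFin n

    1≤N : 1ℚ ≤ N
    1≤N = ι-mono 1≤n

  open Rate 1≤N Nh 0≤h 0≤γ β≡ βγ≡1
  open Weight 1≤β 0≤γ βγ≡1

  Φ Ψ : Loads n → ℕ → ℚ
  Φ x t = ∑ bins (λ i → w (n ℕ.* x i) t)
  Ψ x t = ∑ bins (λ i → w t (n ℕ.* x i))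

  0≤Φ : ∀ x t → 0ℚ ≤ Φ x t
  0≤Φ x t = ∑-nonneg bins (λ i → 0≤w (n ℕ.* x i) t)

  0≤Ψ : ∀ x t → 0ℚ ≤ Ψ x t
  0≤Ψ x t = ∑-nonneg bins (λ i → 0≤w t (n ℕ.* x i))

  w-up : ∀ y t → w (n ℕ.* suc y) (suc t) ≡ γ * (β ^ n * w (n ℕ.* y) t)
  w-up y t = trans (cong (λ a → w a (suc t)) (ℕ.*-suc n y)) (trans (w-* n 1 (n ℕ.* y) t)
    (solve 3 (λ B g x → B :* (g :* con 1ℚ) :* x := g :* (B :* x)) refl (β ^ n) γ (w (n ℕ.* y) t)))

  w-down : ∀ y t → w (suc t) (n ℕ.* suc y) ≡ β * (γ ^ n * w t (n ℕ.* y))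
  w-down y t = trans (cong (w (suc t)) (ℕ.*-suc n y)) (trans (w-* 1 n t (n ℕ.* y))
    (solve 3 (λ B g x → g :* con 1ℚ :* B :* x := g :* (B :* x)) refl (γ ^ n) β (w t (n ℕ.* y))))

  -- Advancing t multiplies every weight by γ; the chosen bin alone also gets the factor βⁿ, as n
  -- times its load grows by n.
  Φ-addBall : ∀ x k t → Φ (addBall x k) (suc t) ≡ γ * (Φ x t + (β ^ n - 1ℚ) * w (n ℕ.* x k) t)
  Φ-addBall x k t = trans (∑-addBall x k (λ y → w (n ℕ.* y) (suc t))) (trans
    (cong₂ _+_ (trans (∑-cong bins (λ i → stay (x i))) (∑-* bins γ (λ i → w (n ℕ.* x i) t)))
      (cong₂ _-_ (w-up (x k) t) (stay (x k))))
    (solve 4 (λ g B P x → g :* P :+ (g :* (B :* x) :- g :* x) := g :* (P :+ (B :- con 1ℚ) :* x)) refl γ (β ^ n) (Φ x t) (w (n ℕ.* x k) t)))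
    where
    stay : ∀ y → w (n ℕ.* y) (suc t) ≡ γ * w (n ℕ.* y) t
    stay y = solve 3 (λ b g c → b :* (g :* c) := g :* (b :* c)) refl (β ^ (n ℕ.* y)) γ (γ ^ t)

  Ψ-addBall : ∀ x k t → Ψ (addBall x k) (suc t) ≡ β * (Ψ x t - (1ℚ - γ ^ n) * w t (n ℕ.* x k))
  Ψ-addBall x k t = trans (∑-addBall x k (λ y → w (suc t) (n ℕ.* y))) (trans
    (cong₂ _+_ (trans (∑-cong bins (λ i → stay (x i))) (∑-* bins β (λ i → w t (n ℕ.* x i))))
      (cong₂ _-_ (w-down (x k) t) (stay (x k))))
    (solve 4 (λ g B P x → g :* P :+ (g :* (B :* x) :- g :* x) := g :* (P :- (con 1ℚ :- B) :* x)) refl β (γ ^ n) (Ψ x t) (w t (n ℕ.* x k))))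
    where
    stay : ∀ y → w (suc t) (n ℕ.* y) ≡ β * w t (n ℕ.* y)
    stay y = *-assoc β (β ^ t) (γ ^ (n ℕ.* y))

  module State {d : ℕ} (n≤3d : n ℕ.≤ 3 ℕ.* d) (3d≤2n : 3 ℕ.* d ℕ.≤ 2 ℕ.* n) {x : Loads n} {r : Rank n} (ranking : IsRanking x r)
    (t : ℕ) (sum≡ : ∑ bins (λ i → ι (x i)) ≡ ι t) where

    private
      d≤n : d ℕ.≤ n
      d≤n = ℕ.*-cancelˡ-≤ 3 (ℕ.≤-trans 3d≤2n (ℕ.*-monoˡ-≤ n (ℕ.n≤1+n 2)))

      D = ι d

      N≤3D : N ≤ (ℤ.+ 3 / 1) * D
      N≤3D = ≤-trans (ι-mono n≤3d) (≤-reflexive (ι-* 3 d))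

      3D≤2N : (ℤ.+ 3 / 1) * D ≤ (ℤ.+ 2 / 1) * N
      3D≤2N = ≤-trans (≤-reflexive (sym (ι-* 3 d))) (≤-trans (ι-mono 3d≤2n) (≤-reflexive (ι-* 2 n)))

      l : Fin n → Bool
      l = light d r

      count : ∑ bins (λ i → 𝟙 (l i)) ≡ N - D
      count = count-light {d = d} ranking d≤n

    -- The new ball lands in bin i with probability (d + n 𝟙 (l i)) / n².
    weighted : (Fin n → ℚ) → ℚ
    weighted f = D * ∑ bins f + N * ∑ bins (λ i → 𝟙 (l i) * f i)

    private
      weighted-bounds : ∀ {f} → (∀ i → 0ℚ ≤ f i) → 0ℚ ≤ weighted f × weighted f ≤ (ℤ.+ 2 / 1) * N * ∑ bins f
      weighted-bounds {f} 0≤f =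
          0≤ι d ⊗ 0≤F ⊕ 0≤ι n ⊗ ∑-nonneg bins (λ i → 0≤𝟙 (l i) ⊗ 0≤f i)
        , ≤-by (slack (ι-mono d≤n) ⊗ 0≤F ⊕ 0≤ι n ⊗ slack (∑-mono bins (λ i → part (l i) (0≤f i))))
            (solve 4 (λ N D F L → con (ℤ.+ 2 / 1) :* N :* F := D :* F :+ N :* L :+ ((N :- D) :* F :+ N :* (F :- L)))
              refl N D (∑ bins f) (∑ bins (λ i → 𝟙 (l i) * f i)))
        where
        0≤F : 0ℚ ≤ ∑ bins f
        0≤F = ∑-nonneg bins 0≤f
        part : ∀ b {y} → 0ℚ ≤ y → 𝟙 b * y ≤ y
        part true  {y} 0≤y = ≤-reflexive (*-identityˡ y)
        part false {y} 0≤y = ≤-trans (≤-reflexive (*-zeroˡ y)) 0≤y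

      complement : ∀ f → ∑ bins (λ i → 𝟙 (not (l i)) * f i) ≡ ∑ bins f - ∑ bins (λ i → 𝟙 (l i) * f i)
      complement f = trans (solve 2 (λ x y → x := x :+ y :- y) refl (∑ bins (λ i → 𝟙 (not (l i)) * f i)) (∑ bins (λ i → 𝟙 (l i) * f i)))
        (cong (_- ∑ bins (λ i → 𝟙 (l i) * f i)) (trans (sym (∑-+ bins (λ i → 𝟙 (not (l i)) * f i) (λ i → 𝟙 (l i) * f i)))
          (∑-cong bins (λ i → either (l i) (f i)))))
        where
        either : ∀ b y → 𝟙 (not b) * y + 𝟙 b * y ≡ y
        either true  y = solve 1 (λ y → con 0ℚ :* y :+ con 1ℚ :* y := y) refl y
        either false y = solve 1 (λ y → con 1ℚ :* y :+ con 0ℚ :* y := y) refl y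

      counth : ∑ bins (λ i → 𝟙 (not (l i))) ≡ D
      counth = trans (∑-cong bins (λ i → sym (*-identityʳ (𝟙 (not (l i)))))) (trans (complement (λ _ → 1ℚ)) (trans
        (cong₂ _-_ (sym (∑-bins n)) (trans (∑-cong bins (λ i → *-identityʳ (𝟙 (l i)))) count))
        (solve 2 (λ N D → N :- (N :- D) := D) refl N D)))

      balanced : ∑ bins (λ i → ι (n ℕ.* x i)) ≡ ∑ bins (λ _ → ι t)
      balanced = trans (∑-cong bins (λ i → ι-* n (x i))) (trans (∑-* bins N (λ i → ι (x i)))
        (trans (cong (N *_) sum≡) (trans (*-comm N (ι t)) (sym (∑-const-bins n (ι t))))))

    φ ψ : Fin n → ℚ
    φ i = w (n ℕ.* x i) t
    ψ i = w t (n ℕ.* x i)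

    -- The sign of nτ - t decides which side is marked. If n τ ≥ t, the d heavy bins are marked and
    -- W is Φ; otherwise the n - d light bins are marked and W is Ψ. In both cases `drift-W` and
    -- `drift-V` become the two claims after splitting a total into heavy and light parts.
    drifts : (weighted φ - N * ∑ bins φ ≤ drift N (∑ bins φ) (∑ bins ψ))
           × (N * ∑ bins ψ - weighted ψ ≤ drift N (∑ bins ψ) (∑ bins φ))
    drifts with threshold x l (light-below {d = d} ranking)
    ... | τ , heavy≥τ , light≤τ with ℕ.≤-total t (n ℕ.* τ)
    ...   | inj₁ t≤nτ =
        subst (_≤ drift N (∑ bins φ) (∑ bins ψ))
          (trans (cong (λ y → D * ∑ bins φ - N * y) (complement φ))
            (solve 4 (λ N D F L → D :* F :- N :* (F :- L) := D :* F :+ N :* L :- N :* F) refl N D (∑ bins φ) (∑ bins (λ i → 𝟙 (l i) * φ i)))) drift-W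
      , subst (_≤ drift N (∑ bins ψ) (∑ bins φ))
          (trans (cong (λ y → N * y - D * ∑ bins ψ) (complement ψ))
            (solve 4 (λ N D F L → N :* (F :- L) :- D :* F := N :* F :- (D :* F :+ N :* L)) refl N D (∑ bins ψ) (∑ bins (λ i → 𝟙 (l i) * ψ i)))) drift-V
      where
      level : n ℕ.* τ ℕ.∸ t ℕ.+ t ≡ n ℕ.* τ
      level = ℕ.m∸n+n≡m t≤nτ
      heavy : ∀ {i} → not (l i) ≡ true → l i ≡ false
      heavy {i} eq with l i
      ... | false = refl
      lighter : ∀ {i} → not (l i) ≡ false → l i ≡ true
      lighter {i} eq with l i
      ... | true = refl
      open Split (λ i → not (l i)) (λ i → n ℕ.* x i) (λ _ → t) (n ℕ.* τ ℕ.∸ t)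
        (λ i eq → ℕ.≤-trans (ℕ.≤-reflexive level) (ℕ.*-monoʳ-≤ n (heavy≥τ i (heavy {i} eq))))
        (λ i eq → ℕ.≤-trans (ℕ.*-monoʳ-≤ n (light≤τ i (lighter {i} eq))) (ℕ.≤-reflexive (sym level)))
        balanced N D (∑-bins n) (sym counth) N≤3D 3D≤2N 1≤N
    ...   | inj₂ nτ≤t =
        subst (_≤ drift N (∑ bins φ) (∑ bins ψ))
          (solve 4 (λ N D F L → N :* L :- (N :- D) :* F := D :* F :+ N :* L :- N :* F) refl N D (∑ bins φ) (∑ bins (λ i → 𝟙 (l i) * φ i))) drift-V
      , subst (_≤ drift N (∑ bins ψ) (∑ bins φ))
          (solve 4 (λ N D F L → (N :- D) :* F :- N :* L := N :* F :- (D :* F :+ N :* L)) refl N D (∑ bins ψ) (∑ bins (λ i → 𝟙 (l i) * ψ i))) drift-W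
      where
      level : t ℕ.∸ n ℕ.* τ ℕ.+ n ℕ.* τ ≡ t
      level = ℕ.m∸n+n≡m nτ≤t
      open Split l (λ _ → t) (λ i → n ℕ.* x i) (t ℕ.∸ n ℕ.* τ)
        (λ i eq → ℕ.≤-trans (ℕ.+-monoʳ-≤ (t ℕ.∸ n ℕ.* τ) (ℕ.*-monoʳ-≤ n (light≤τ i eq))) (ℕ.≤-reflexive level))
        (λ i eq → ℕ.≤-trans (ℕ.≤-reflexive (sym level)) (ℕ.+-monoʳ-≤ (t ℕ.∸ n ℕ.* τ) (ℕ.*-monoʳ-≤ n (heavy≥τ i eq))))
        (sym balanced) N (N - D) (∑-bins n) (sym count)
        -- The range n/3 ≤ d ≤ 2n/3 is symmetric under replacing d by n - d, so each bound follows
        -- from the other one.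
        (≤-by (slack 3D≤2N) (solve 2 (λ N D → con (ℤ.+ 3 / 1) :* (N :- D) := N :+ (con (ℤ.+ 2 / 1) :* N :- con (ℤ.+ 3 / 1) :* D)) refl N D))
        (≤-by (slack N≤3D) (solve 2 (λ N D → con (ℤ.+ 2 / 1) :* N := con (ℤ.+ 3 / 1) :* (N :- D) :+ (con (ℤ.+ 3 / 1) :* D :- N)) refl N D))
        1≤N

    ∑-step : ∑ (samples n) (λ s → Φ (addBall x (choose d r s)) (suc t) + Ψ (addBall x (choose d r s)) (suc t))
           ≤ ((ℤ.+ 2 / 1) * (N * N) - (ℤ.+ 1 / 7200) * N) * (Φ x t + Ψ x t) + (ℤ.+ 18 / 1) * (N * N * N)
    ∑-step = subst (_≤ ((ℤ.+ 2 / 1) * (N * N) - (ℤ.+ 1 / 7200) * N) * (Φ x t + Ψ x t) + (ℤ.+ 18 / 1) * (N * N * N))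
      (sym (trans (∑-+ (samples n) _ _) (cong₂ _+_ up down)))
      (step-bound (0≤Φ x t) (0≤Ψ x t) (proj₁ φ-bounds) (proj₂ φ-bounds) (proj₁ ψ-bounds) (proj₂ ψ-bounds)
        (β^n≤ n refl) (γ^n≤ n refl) (proj₁ drifts) (proj₂ drifts))
      where
      φ-bounds = weighted-bounds {φ} (λ i → 0≤w (n ℕ.* x i) t)
      ψ-bounds = weighted-bounds {ψ} (λ i → 0≤w t (n ℕ.* x i))
      -- Each potential after the step is affine in the old weight of the chosen bin, so `∑-choose`
      -- is all that averaging requires.
      affine : ∀ a c f → ∑ (samples n) (λ s → a + c * f (choose d r s))
             ≡ (ℤ.+ 2 / 1) * (N * N) * a + c * ((ℤ.+ 2 / 1) * weighted f)
      affine a c f = trans (∑-+ (samples n) (λ _ → a) (λ s → c * f (choose d r s))) (cong₂ _+_ (∑-samples-const n a)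
        (trans (∑-* (samples n) c (λ s → f (choose d r s))) (cong (c *_) (∑-choose d r f count))))
      up : ∑ (samples n) (λ s → Φ (addBall x (choose d r s)) (suc t))
         ≡ γ * ((ℤ.+ 2 / 1) * (N * N) * Φ x t + (β ^ n - 1ℚ) * ((ℤ.+ 2 / 1) * weighted φ))
      up = trans (∑-cong (samples n) (λ s → Φ-addBall x (choose d r s) t))
        (trans (∑-* (samples n) γ _) (cong (γ *_) (affine (Φ x t) (β ^ n - 1ℚ) φ)))
      down : ∑ (samples n) (λ s → Ψ (addBall x (choose d r s)) (suc t))
         ≡ β * ((ℤ.+ 2 / 1) * (N * N) * Ψ x t - (1ℚ - γ ^ n) * ((ℤ.+ 2 / 1) * weighted ψ))
      down = trans (∑-cong (samples n) (λ s → trans (Ψ-addBall x (choose d r s) t) (cong (β *_)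
          (solve 3 (λ a c f → a :- c :* f := a :+ (con 0ℚ :- c) :* f) refl (Ψ x t) (1ℚ - γ ^ n) (ψ (choose d r s))))))
        (trans (∑-* (samples n) β _) (cong (β *_) (trans (affine (Ψ x t) (0ℚ - (1ℚ - γ ^ n)) ψ)
          (solve 4 (λ M a c f → M :* a :+ (con 0ℚ :- c) :* f := M :* a :- c :* f) refl
            ((ℤ.+ 2 / 1) * (N * N)) (Ψ x t) (1ℚ - γ ^ n) ((ℤ.+ 2 / 1) * weighted ψ)))))

  module _ {d : ℕ} (n≤3d : n ℕ.≤ 3 ℕ.* d) (3d≤2n : 3 ℕ.* d ℕ.≤ 2 ℕ.* n)
    {rule : TieRule n} (ranking : ∀ h → IsRanking (loads d rule h) (rule h)) where

    Γ : List (Sample n) → ℚ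
    Γ h = Φ (loads d rule h) (length h) + Ψ (loads d rule h) (length h)

    0≤Γ : ∀ h → 0ℚ ≤ Γ h
    0≤Γ h = 0≤Φ (loads d rule h) (length h) ⊕ 0≤Ψ (loads d rule h) (length h)

    private
      P = (ℤ.+ 2 / 1) * (N * N)

    ∑-histories-1 : ∀ m → ∑ (histories n m) (λ _ → 1ℚ) ≡ P ^ m
    ∑-histories-1 zero    = refl
    ∑-histories-1 (suc m) = trans (∑-histories-suc n m (λ _ → 1ℚ)) (trans
      (∑-cong (histories n m) (λ _ → ∑-samples-const n 1ℚ)) (trans (∑-* (histories n m) P (λ _ → 1ℚ))
      (cong (P *_) (∑-histories-1 m))))

    -- The constant is the fixed point of the recursion: for a mean of 129600 N², the decay (N/7200)
    -- · 129600 N² equals the added 18 N³. The start value 2N lies below it.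
    ∑-Γ-bound : ∀ m → ∑ (histories n m) Γ ≤ (ℤ.+ 129600 / 1) * (N * N) * P ^ m
    ∑-Γ-bound zero = ≤-by (0≤const (ℤ.+ 2 / 1) ⊗ 0≤N ⊗ slack 1≤N ⊕ 0≤const (ℤ.+ 129598 / 1) ⊗ 0≤N ⊗ 0≤N)
      (trans (solve 1 (λ N → con (ℤ.+ 129600 / 1) :* (N :* N) :* con 1ℚ
          := con 1ℚ :* N :+ con 1ℚ :* N :+ con 0ℚ :+ (con (ℤ.+ 2 / 1) :* N :* (N :- con 1ℚ) :+ con (ℤ.+ 129598 / 1) :* N :* N)) refl N)
        (cong (λ y → y + 0ℚ + ((ℤ.+ 2 / 1) * N * (N - 1ℚ) + (ℤ.+ 129598 / 1) * N * N))
          (cong₂ _+_ (sym (trans (∑-cong bins (λ _ → cong (λ a → w a 0) (ℕ.*-zeroʳ n))) (∑-const-bins n 1ℚ)))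
                     (sym (trans (∑-cong bins (λ _ → cong (w 0) (ℕ.*-zeroʳ n))) (∑-const-bins n 1ℚ))))))
    ∑-Γ-bound (suc m) = ≤-trans (≤-reflexive (∑-histories-suc n m Γ)) (≤-trans
      (∑-mono (histories n m) step) (≤-trans (≤-reflexive sum) (≤-by (0≤P-N ⊗ slack (∑-Γ-bound m))
        (solve 3 (λ N Q G → con (ℤ.+ 129600 / 1) :* (N :* N) :* (con (ℤ.+ 2 / 1) :* (N :* N) :* Q)
          := (con (ℤ.+ 2 / 1) :* (N :* N) :- con (ℤ.+ 1 / 7200) :* N) :* G :+ con (ℤ.+ 18 / 1) :* (N :* N :* N) :* Q
          :+ (con (ℤ.+ 2 / 1) :* (N :* N) :- con (ℤ.+ 1 / 7200) :* N) :* (con (ℤ.+ 129600 / 1) :* (N :* N) :* Q :- G))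
          refl N (P ^ m) (∑ (histories n m) Γ)))))
      where
      c = P - (ℤ.+ 1 / 7200) * N
      k = (ℤ.+ 18 / 1) * (N * N * N)
      0≤P-N : 0ℚ ≤ c
      0≤P-N = ≤-by (0≤const (ℤ.+ 2 / 1) ⊗ 0≤N ⊗ slack 1≤N ⊕ 0≤const (ℤ.+ 14399 / 7200) ⊗ 0≤N)
        (solve 1 (λ N → con (ℤ.+ 2 / 1) :* (N :* N) :- con (ℤ.+ 1 / 7200) :* N := con 0ℚ :+
          (con (ℤ.+ 2 / 1) :* N :* (N :- con 1ℚ) :+ con (ℤ.+ 14399 / 7200) :* N)) refl N)
      step : ∀ h → ∑ (samples n) (λ s → Γ (s ∷ h)) ≤ c * Γ h + k * 1ℚ
      step h = ≤-trans (State.∑-step {d} n≤3d 3d≤2n (ranking h) (length h) (∑-loads d rule h))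
        (≤-reflexive (cong (c * Γ h +_) (sym (*-identityʳ k))))
      sum : ∑ (histories n m) (λ h → c * Γ h + k * 1ℚ) ≡ c * ∑ (histories n m) Γ + k * P ^ m
      sum = trans (∑-+ (histories n m) (λ h → c * Γ h) (λ _ → k * 1ℚ)) (cong₂ _+_ (∑-* (histories n m) c Γ)
        (trans (∑-* (histories n m) k (λ _ → 1ℚ)) (cong (k *_) (∑-histories-1 m))))

-- The exponential series

-- k! Σ_{j≤k} x^j / j!
expℚ : ℚ → ℕ → ℚ
expℚ x zero    = 1ℚ
expℚ x (suc k) = ι (suc k) * expℚ x k + x ^ suc k

ι-expNum : ∀ a k → ι (expNum a k) ≡ expℚ (ι a) k
ι-expNum a zero    = refl
ι-expNum a (suc k) = trans (ι-+ (suc k ℕ.* expNum a k) (a ℕ.^ suc k))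
  (cong₂ _+_ (trans (ι-* (suc k) (expNum a k)) (cong (ι (suc k) *_) (ι-expNum a k))) (ι-^ a (suc k)))

expℚ-0 : ∀ k → expℚ 0ℚ k ≡ ι (k !)
expℚ-0 zero    = refl
expℚ-0 (suc k) = trans (trans (cong (λ x → ι (suc k) * x + 0ℚ ^ suc k) (expℚ-0 k))
  (solve 3 (λ k f z → k :* f :+ con 0ℚ :* z := k :* f) refl (ι (suc k)) (ι (k !)) (0ℚ ^ k))) (sym (ι-* (suc k) (k !)))

pow-mono-base : ∀ {x y} k → 0ℚ ≤ x → x ≤ y → x ^ k ≤ y ^ k
pow-mono-base zero    0≤x x≤y = ≤-refl
pow-mono-base (suc k) 0≤x x≤y = *-mono-≤ 0≤x (0≤pow k (≤-trans 0≤x x≤y)) x≤y (pow-mono-base k 0≤x x≤y)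

module _ {y u : ℚ} (0≤y : 0ℚ ≤ y) (0≤u : 0ℚ ≤ u) where

  private
    v = y + u
    0≤v : 0ℚ ≤ v
    0≤v = 0≤y ⊕ 0≤u

  -- The mean value bound for a power, with the derivative taken at the larger end v.
  pow-increment : ∀ k → v ^ suc k - y ^ suc k ≤ ι (suc k) * u * v ^ k
  pow-increment zero    = ≤-reflexive (solve 2 (λ y u → (y :+ u) :* con 1ℚ :- y :* con 1ℚ
    := (con 1ℚ :+ con 0ℚ) :* u :* con 1ℚ) refl y u)
  pow-increment (suc k) = ≤-by
    (0≤v ⊗ slack (pow-increment k) ⊕ 0≤u ⊗ slack (pow-mono-base (suc k) 0≤y (≤-by 0≤u refl)))
    (solve 5 (λ y u K V Y → (con 1ℚ :+ K) :* u :* ((y :+ u) :* V) := (y :+ u) :* ((y :+ u) :* V) :- y :* (y :* Y)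
      :+ ((y :+ u) :* (K :* u :* V :- ((y :+ u) :* V :- y :* Y)) :+ u :* ((y :+ u) :* V :- y :* Y)))
      refl y u (ι (suc k)) (v ^ k) (y ^ k))

  0≤expℚ : ∀ k → 0ℚ ≤ expℚ v k
  0≤expℚ zero    = 0≤const 1ℚ
  0≤expℚ (suc k) = 0≤ι (suc k) ⊗ 0≤expℚ k ⊕ 0≤pow (suc k) 0≤v

  -- The derivative of a partial sum of the exponential series is the preceding partial sum; this is
  -- the mean value bound with factorials cleared.
  expℚ-increment : ∀ k → expℚ v (suc k) - expℚ y (suc k) ≤ u * (ι (suc k) * expℚ v k)
  expℚ-increment zero    = ≤-reflexive (solve 2 (λ y u → let o = con 1ℚ :+ con 0ℚ in
    o :* con 1ℚ :+ (y :+ u) :* con 1ℚ :- (o :* con 1ℚ :+ y :* con 1ℚ) := u :* (o :* con 1ℚ)) refl y u)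
  expℚ-increment (suc k) = ≤-by
    (0≤ι (2 ℕ.+ k) ⊗ slack (expℚ-increment k) ⊕ slack (pow-increment (suc k)))
    (solve 8 (λ u K L T P Q V Y → u :* (L :* (K :* T :+ V)) :=
        L :* (K :* T :+ V) :+ P :- (L :* Y :+ Q)
        :+ (L :* (u :* (K :* T) :- (K :* T :+ V :- Y)) :+ (L :* u :* V :- (P :- Q))))
      refl u (ι (suc k)) (ι (2 ℕ.+ k)) (expℚ v k) (v ^ (2 ℕ.+ k)) (y ^ (2 ℕ.+ k)) (v ^ suc k) (expℚ y (suc k)))

  -- This is e^u (1 - u) ≤ 1 at the level of partial sums: `expℚ-increment` bounds the growth by u
  -- times the preceding partial sum, hence by u times the current one.
  expℚ-shift : ∀ k → (1ℚ - u) * expℚ v k ≤ expℚ y k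
  expℚ-shift zero    = ≤-by 0≤u (solve 1 (λ u → con 1ℚ := (con 1ℚ :- u) :* con 1ℚ :+ u) refl u)
  expℚ-shift (suc k) = ≤-by (slack (expℚ-increment k) ⊕ 0≤u ⊗ 0≤pow (suc k) 0≤v)
    (solve 5 (λ u K T P Y → Y := (con 1ℚ :- u) :* (K :* T :+ P) :+ (u :* (K :* T) :- (K :* T :+ P :- Y) :+ u :* P))
      refl u (ι (suc k)) (expℚ v k) (v ^ suc k) (expℚ y (suc k)))

-- e^{Nu} ≤ (1 − u)^{−N} for every partial sum of the exponential series
expℚ-bound : ∀ {u} k → 0ℚ ≤ u → 0ℚ ≤ 1ℚ - u → ∀ N → (1ℚ - u) ^ N * expℚ (ι N * u) k ≤ ι (k !)
expℚ-bound {u} k 0≤u 0≤1-u zero    = ≤-reflexive (trans (*-identityˡ _)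
  (trans (cong (λ x → expℚ x k) (*-zeroˡ u)) (expℚ-0 k)))
expℚ-bound {u} k 0≤u 0≤1-u (suc N) = ≤-trans (≤-reflexive (trans
    (cong (λ x → (1ℚ - u) ^ suc N * expℚ x k) (solve 2 (λ N u → (con 1ℚ :+ N) :* u := N :* u :+ u) refl (ι N) u))
    (solve 3 (λ g G e → g :* G :* e := G :* (g :* e)) refl (1ℚ - u) ((1ℚ - u) ^ N) (expℚ (ι N * u + u) k))))
  (≤-trans (*-monoˡ (0≤pow N 0≤1-u) (expℚ-shift (0≤ι N ⊗ 0≤u) 0≤u k)) (expℚ-bound k 0≤u 0≤1-u N))

-- The alternative 0 is the default value of the fold.
maxLoad-attained : ∀ {n} (x : Loads n) → maxLoad x ≡ 0 ⊎ ∃ λ i → maxLoad x ≡ x i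
maxLoad-attained {n} x = go (allFin n)
  where
  go : ∀ is → foldr (λ i acc → x i ℕ.⊔ acc) 0 is ≡ 0 ⊎ ∃ λ i → foldr (λ i acc → x i ℕ.⊔ acc) 0 is ≡ x i
  go []       = inj₁ refl
  go (i ∷ is) with ℕ.⊔-sel (x i) (foldr (λ i acc → x i ℕ.⊔ acc) 0 is)
  ... | inj₁ eq = inj₂ (i , eq)
  ... | inj₂ eq with go is
  ...   | inj₁ eq₀       = inj₁ (trans eq eq₀)
  ...   | inj₂ (j , eqⱼ) = inj₂ (j , trans eq eqⱼ)

-- From a large gap to a large potential, and Markov's inequality.

module Process {n : ℕ} (1≤n : 1 ℕ.≤ n) where

  private
    N M : ℚ
    N = ι n
    M = ι (50 ℕ.* n)

    positive-≥1 : ∀ {x} → 1ℚ ≤ x → Positive x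
    positive-≥1 1≤x = positive (<-≤-trans (positive⁻¹ 1ℚ) 1≤x)

    1≤N : 1ℚ ≤ N
    1≤N = ι-mono 1≤n

    instance
      N-positive : Positive N
      N-positive = positive-≥1 1≤N
      N-nonZero : NonZero N
      N-nonZero = pos⇒nonZero N

    h β : ℚ
    h = (ℤ.+ 1 / 50) * 1/ N
    β = 1ℚ + h

    0≤h : 0ℚ ≤ h
    0≤h = 0≤const (ℤ.+ 1 / 50) ⊗ <⇒≤ (positive⁻¹ (1/ N) {{1/pos⇒pos N}})

    instance
      β-positive : Positive β
      β-positive = positive-≥1 (≤-by 0≤h refl)
      β-nonZero : NonZero β
      β-nonZero = pos⇒nonZero β

    γ : ℚ
    γ = 1/ β

    0≤γ : 0ℚ ≤ γ
    0≤γ = <⇒≤ (positive⁻¹ (1/ β) {{1/pos⇒pos β}})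

    Nh : N * h ≡ ℤ.+ 1 / 50
    Nh = trans (solve 2 (λ N k → N :* (con (ℤ.+ 1 / 50) :* k) := con (ℤ.+ 1 / 50) :* (N :* k)) refl N (1/ N))
      (trans (cong ((ℤ.+ 1 / 50) *_) (*-inverseʳ N)) (*-identityʳ (ℤ.+ 1 / 50)))

    βγ≡1 : β * γ ≡ 1ℚ
    βγ≡1 = *-inverseʳ β

  open Potential 1≤n Nh 0≤h 0≤γ refl βγ≡1 hiding (N)
  open Rate 1≤N Nh 0≤h 0≤γ (refl {x = β}) βγ≡1 using (1≤β; 0≤β; γ+γh≡1; pow-inverse)
  open Weight 1≤β 0≤γ βγ≡1

  private
    u : ℚ
    u = γ * h

    0≤u : 0ℚ ≤ u
    0≤u = 0≤γ ⊗ 0≤h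

    1-u≡γ : 1ℚ - u ≡ γ
    1-u≡γ = trans (cong (_- u) (sym γ+γh≡1)) (solve 2 (λ g u → g :+ u :- u := g) refl γ u)

    Mh : M * h ≡ 1ℚ
    Mh = trans (cong (_* h) (ι-* 50 n)) (trans (*-assoc (ι 50) N h) (cong (ι 50 *_) Nh))

    [1+M]u≡1 : (1ℚ + M) * u ≡ 1ℚ
    [1+M]u≡1 = trans (solve 3 (λ M g h → (con 1ℚ :+ M) :* (g :* h) := g :* h :+ g :* (M :* h)) refl M γ h)
      (trans (cong (λ x → u + γ * x) Mh) (trans (solve 2 (λ u g → u :+ g :* con 1ℚ := g :+ u) refl u γ) γ+γh≡1))

  -- Here u = γ h = 1/(50n + 1) and 1 - u = γ. For K = a (50n + 1) one has K u = a, so `expℚ-bound`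
  -- reads γ^K e^a ≤ 1, and multiplying by β^K gives the claim.
  exp≤pow : ∀ a k → ι (expNum a k) ≤ β ^ (a ℕ.* suc (50 ℕ.* n)) * ι (k !)
  exp≤pow a k = subst₂ _≤_
    (trans (sym (*-assoc (β ^ K) (γ ^ K) e)) (trans (cong (_* e) (pow-inverse K)) (trans (*-identityˡ e) (sym (ι-expNum a k)))))
    refl
    (*-monoˡ (0≤pow K 0≤β) (subst (_≤ ι (k !))
      (cong₂ (λ g x → g ^ K * expℚ x k) 1-u≡γ Ku≡a)
      (expℚ-bound k 0≤u (subst (0ℚ ≤_) (sym 1-u≡γ) 0≤γ) K)))
    where
    K = a ℕ.* suc (50 ℕ.* n)
    e = expℚ (ι a) k
    Ku≡a : ι K * u ≡ ι a
    Ku≡a = trans (cong (_* u) (ι-* a (suc (50 ℕ.* n)))) (trans (*-assoc (ι a) (1ℚ + M) u)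
      (trans (cong (ι a *_) [1+M]u≡1) (*-identityʳ (ι a))))

  -- Since e ≤ β^(50n + 1), the exponent 4 works because 4 (50n + 1) ≤ 300 n.
  pow≤⇒ExpLe : ∀ a → β ^ a ≤ N ^ 4 → ExpLe a (n ℕ.^ (300 ℕ.* n))
  pow≤⇒ExpLe a β^a≤ k = ι-cancel-≤ (≤-trans (exp≤pow a k) (≤-trans
      (≤-reflexive (*-comm (β ^ (a ℕ.* K)) (ι (k !)))) (≤-trans (*-monoˡ (0≤ι (k !)) pow≤)
      (≤-reflexive (trans (*-comm (ι (k !)) (ι (n ℕ.^ (300 ℕ.* n)))) (sym (ι-* (n ℕ.^ (300 ℕ.* n)) (k !))))))))
    where
    K = suc (50 ℕ.* n)
    exponent : 4 ℕ.* K ℕ.≤ 300 ℕ.* n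
    exponent = begin
      4 ℕ.* K                   ≡⟨ ℕ.*-suc 4 (50 ℕ.* n) ⟩
      4 ℕ.+ 4 ℕ.* (50 ℕ.* n)    ≡⟨ cong (4 ℕ.+_) (sym (ℕ.*-assoc 4 50 n)) ⟩
      4 ℕ.+ 200 ℕ.* n           ≤⟨ ℕ.+-monoˡ-≤ (200 ℕ.* n) (ℕ.*-mono-≤ {4} {100} (ℕ.m≤m+n 4 96) 1≤n) ⟩
      100 ℕ.* n ℕ.+ 200 ℕ.* n   ≡⟨ sym (ℕ.*-distribʳ-+ n 100 200) ⟩
      300 ℕ.* n                 ∎
      where open ℕ.≤-Reasoning
    pow≤ : β ^ (a ℕ.* K) ≤ ι (n ℕ.^ (300 ℕ.* n))
    pow≤ = ≤-trans (≤-reflexive (sym (^-assocʳ β a K))) (≤-trans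
      (pow-mono-base K (0≤pow a 0≤β) β^a≤) (≤-trans (≤-reflexive (^-assocʳ N 4 K))
      (≤-trans (pow-mono 1≤N exponent) (≤-reflexive (sym (ι-^ n (300 ℕ.* n)))))))

  module _ {d : ℕ} (n≤3d : n ℕ.≤ 3 ℕ.* d) (3d≤2n : 3 ℕ.* d ℕ.≤ 2 ℕ.* n)
    {rule : TieRule n} (ranking : ∀ h → IsRanking (loads d rule h) (rule h)) where

    private
      Γ′ = Γ n≤3d 3d≤2n {rule} ranking

    -- By `pow≤⇒ExpLe` a gap that is not small forces β^a > n⁴, and β^a is at most the weight of a
    -- fullest bin in Φ.
    ¬GapSmall⇒Γ-large : ∀ h → ¬ GapSmall n (loads d rule h) (length h) → N ^ 4 ≤ Γ′ h
    ¬GapSmall⇒Γ-large h ¬small = ≤-trans (<⇒≤ N⁴<) (≤-trans (large (maxLoad-attained x))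
        (≤-by (0≤Ψ x t) refl))
      where
      x = loads d rule h
      t = length h
      a = n ℕ.* maxLoad x ℕ.∸ t
      N⁴< : N ^ 4 < β ^ a
      N⁴< = ≰⇒> (λ β^a≤ → ¬small (pow≤⇒ExpLe a β^a≤))
      -- If the truncated difference a were 0, then β^a = 1 ≤ N⁴. So nothing is truncated, n ·
      -- `maxLoad x` = a + t, and the case of maximum 0 is excluded.
      a≢0 : a ≢ 0
      a≢0 a≡0 = <-irrefl refl (<-≤-trans (subst (λ a → N ^ 4 < β ^ a) a≡0 N⁴<) (1≤pow 4 1≤N))
      large : maxLoad x ≡ 0 ⊎ (∃ λ i → maxLoad x ≡ x i) → β ^ a ≤ Φ x t
      large (inj₁ eq) = ⊥-elim (a≢0 (trans (cong (λ m → n ℕ.* m ℕ.∸ t) eq) (trans (cong (ℕ._∸ t) (ℕ.*-zeroʳ n)) (ℕ.0∸n≡0 t))))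
      large (inj₂ (i , eq)) = ≤-trans (≤-reflexive (sym (*-identityʳ (β ^ a)))) (≤-trans
        (w-mono {a} {0} {n ℕ.* x i} {t} (ℕ.≤-reflexive (trans
          (ℕ.m∸n+n≡m {n ℕ.* maxLoad x} {t} (ℕ.<⇒≤ (ℕ.≰⇒> (λ nmax≤t → a≢0 (ℕ.m≤n⇒m∸n≡0 nmax≤t)))))
          (trans (cong (n ℕ.*_) eq) (sym (ℕ.+-identityʳ (n ℕ.* x i)))))))
        (∑-∈ (λ i → 0≤w (n ℕ.* x i) t) (∈-allFin i)))

    -- Markov's inequality as a count: every bad history contributes at least N⁴ to a total of at
    -- most 129600 N² (2N²)^m, and a factor N² cancels. `C` enters through an equation so that `ι`
    -- is not unfolded at a large numeral.
    bad-count : ∀ {C} → ι C ≡ ℤ.+ 129600 / 1 → ∀ m (bad : List (List (Sample n))) → Unique bad →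
      All (λ h → length h ≡ m × ¬ GapSmall n (loads d rule h) m) bad →
      length bad ℕ.* (n ℕ.* n) ℕ.≤ C ℕ.* (2 ℕ.* (n ℕ.* n)) ℕ.^ m
    bad-count {C} C≡ m bad unique all = ι-cancel-≤ (subst₂ _≤_ (sym lhs) (sym rhs)
        (*-cancelʳ-≤-pos (N * N) {{pos*pos⇒pos N N}} (≤-trans (≤-reflexive (sym flat)) (≤-trans
          (markov bad all) (≤-trans (∑-⊆ (0≤Γ n≤3d 3d≤2n ranking) unique member) (≤-trans (∑-Γ-bound n≤3d 3d≤2n ranking m)
          (≤-reflexive (solve 2 (λ N Q → con (ℤ.+ 129600 / 1) :* (N :* N) :* Q := con (ℤ.+ 129600 / 1) :* Q :* (N :* N)) refl N (P ^ m)))))))))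
      where
      P = (ℤ.+ 2 / 1) * (N * N)
      member : ∀ {h} → h ∈ bad → h ∈ histories n m
      member {h} h∈bad = subst (λ m → h ∈ histories n m) (proj₁ (All.lookup all h∈bad)) (∈-histories h)
      markov : ∀ hs → All (λ h → length h ≡ m × ¬ GapSmall n (loads d rule h) m) hs → ∑ hs (λ _ → N ^ 4) ≤ ∑ hs Γ′
      markov []       []                    = ≤-refl
      markov (h ∷ hs) ((refl , ¬small) ∷ all) = +-mono-≤ (¬GapSmall⇒Γ-large h ¬small) (markov hs all)
      flat : ∑ bad (λ _ → N ^ 4) ≡ ι (length bad) * (N * N) * (N * N)
      flat = trans (∑-const bad (N ^ 4)) (solve 2 (λ N b → N :* (N :* (N :* (N :* con 1ℚ))) :* b := b :* (N :* N) :* (N :* N)) refl N (ι (length bad)))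
      lhs : ι (length bad ℕ.* (n ℕ.* n)) ≡ ι (length bad) * (N * N)
      lhs = trans (ι-* (length bad) (n ℕ.* n)) (cong (ι (length bad) *_) (ι-* n n))
      rhs : ι (C ℕ.* (2 ℕ.* (n ℕ.* n)) ℕ.^ m) ≡ (ℤ.+ 129600 / 1) * P ^ m
      rhs = trans (ι-* C ((2 ℕ.* (n ℕ.* n)) ℕ.^ m)) (cong₂ _*_ C≡ (trans (ι-^ (2 ℕ.* (n ℕ.* n)) m)
        (cong (_^ m) (trans (ι-* 2 (n ℕ.* n)) (cong (ι 2 *_) (ι-* n n))))))

theorem5p2 : Σ ℕ λ C → Σ ℕ λ N₀ → ∀ (n : ℕ) → N₀ ℕ.≤ n →
    ∀ (d : ℕ) → n ℕ.≤ 3 ℕ.* d → 3 ℕ.* d ℕ.≤ 2 ℕ.* n →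
    ∀ (rule : TieRule n) → (∀ h → IsRanking (loads d rule h) (rule h)) →
    ∀ (m : ℕ) → 1 ℕ.≤ m →
    ∀ (bad : List (List (Sample n))) → Unique bad →
    All (λ h → length h ≡ m × ¬ GapSmall n (loads d rule h) m) bad →
    length bad ℕ.* (n ℕ.* n) ℕ.≤ C ℕ.* (2 ℕ.* (n ℕ.* n)) ℕ.^ m
-- The constant is 129600 = 18 · 7200; it is factored because ι is unary.
theorem5p2 = 360 ℕ.* 360 , 1 , λ n 1≤n d n≤3d 3d≤2n rule ranking m _ →
  Process.bad-count 1≤n n≤3d 3d≤2n {rule} ranking {360 ℕ.* 360} (ι-* 360 360) m
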